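{- Let $(\alpha_n)_{n\ge 0}$ be complex numbers with $|\alpha_n|<1$, and let $\Phi_n$, $\langle\cdot,\cdot\rangle$ and $\mu_{n,r,s}$ be as in the context. For all nonnegative integers $n,r,s$, the generalized moment $\mu_{n,r,s}$ is a polynomial with integer coefficients in $\{\alpha_j : 0\le j<n+r\}$ and $\{\overline{\alpha_j} : 0\le j<n+r\}$. Moreover, writing $\beta_j=-\overline{\alpha_j}$ for all $j$, $\mu_{n,r,s}$ can be written as a polynomial in the variables $\alpha_0,\alpha_1,\dots,\beta_0,\beta_1,\dots$ all of whose coefficients are positive integers, i.e. as an element of $\mathbb{Z}[\alpha_0,\alpha_1,\dots,\beta_0,\beta_1,\dots]$ with positive coefficients. Finally, the reciprocity \[ \mu_{ -n,r,s}=\overline{\mu_{n,s,r}}\cdot\frac{\prod_{j=0}^{r-1}(1-|\alpha_j|^2)}{\prod_{j=0}^{s-1}(1-|\alpha_j|^2)} \] holds; in particular $\mu_{ -n}=\overline{\mu_n}$.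
   Context: For a polynomial $f(z)=\sum_{k=0}^n a_kz^k$ of degree $n$, write $\overline{f}(z)=\sum_{k=0}^n\overline{a_k}z^k$ and $f^*(z)=z^n\overline{f}(1/z)$. Given complex numbers $\alpha_n$ with $|\alpha_n|<1$, define monic polynomials $\Phi_n$ with $\deg\Phi_n=n$ by $\Phi_0=1$ and $\Phi_{n+1}(z)=z\Phi_n(z)-\overline{\alpha_n}\,\Phi_n^*(z)$ (here $\Phi_n^*(z)=z^n\overline{\Phi_n}(1/z)$). Let $V$ be the space of Laurent polynomials in $z$ over $\mathbb{C}$, and let $\mathcal{L}$ be the unique linear functional on $V$ with $\mathcal{L}(1)=1$ and $\mathcal{L}(\Phi_m(z)\overline{\Phi_n}(1/z))=0$ for $m\ne n$ (for a Laurent polynomial $g$, $\overline{g}$ conjugates all coefficients). Define $\langle f,g\rangle=\mathcal{L}(f(z)\overline{g}(1/z))$ for $f,g\in V$; one has $\langle\Phi_s,\Phi_s\rangle=\prod_{j=0}^{s-1}(1-|\alpha_j|^2)$. For an integer $n$ and nonnegative integers $r,s$, the generalized moment is $\mu_{n,r,s}=\langle\Phi_s(z),z^n\Phi_r(z)\rangle/\langle\Phi_s(z),\Phi_s(z)\rangle$, and $\mu_n=\mu_{n,0,0}=\mathcal{L}(z^{ -n})$. -}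

module Defs where

open import Algebra.Definitions using (Invertible)
open import Data.Bool using (if_then_else_)
open import Data.Integer as ℤ using (ℤ; +_; 0ℤ; 1ℤ)
import Data.Integer.Properties as ℤ
open import Data.List using (List; []; _∷_; _++_; map; cartesianProductWith; foldr)
open import Data.List.Relation.Unary.All using (All)
open import Data.Nat as ℕ using (ℕ; zero; suc; z≤n; s≤s)
import Data.Nat.Properties as ℕ
open import Data.Product using (∃; _×_; _,_; map₁)
open import Data.Rational as ℚ using (ℚ; mkℚ; 0ℚ; 1ℚ; ½; toℚᵘ)
import Data.Rational.Properties as ℚ
open import Data.Rational.Solver using (module +-*-Solver)
open import Data.Rational.Unnormalised as ℚᵘ using (mkℚᵘ; *≤*; *≡*)
import Data.Rational.Unnormalised.Properties as ℚᵘ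
open import Data.Sum using (inj₁; inj₂)
open import Relation.Binary.PropositionalEquality
  using (_≡_; _≢_; refl; sym; trans; cong; cong₂; subst)
open import Relation.Nullary using (yes; no; does)

------------------------------------------------------------------------
-- Rational estimates, needed for the operations on Cauchy sequences

module Rational where
  open import Data.Rational
  open ℚ.≤-Reasoning
  open +-*-Solver

  halves : ∀ ε → ε * ½ + ε * ½ ≡ ε
  halves ε = trans (sym (ℚ.*-distribˡ-+ ε ½ ½)) (ℚ.*-identityʳ ε)

  *-pos : ∀ {p q} → 0ℚ < p → 0ℚ < q → 0ℚ < p * q
  *-pos {p} {q} 0<p 0<q =
    ℚ.positive⁻¹ (p * q) {{ℚ.pos*pos⇒pos p {{positive 0<p}} q {{positive 0<q}}}}

  half-pos : ∀ {ε} → 0ℚ < ε → 0ℚ < ε * ½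
  half-pos 0<ε = *-pos 0<ε (ℚ.positive⁻¹ ½)

  +-nonNeg : ∀ {p q} → 0ℚ ≤ p → 0ℚ ≤ q → 0ℚ ≤ p + q
  +-nonNeg 0≤p 0≤q = ℚ.+-mono-≤ 0≤p 0≤q

  *-nonNeg : ∀ {p q} → 0ℚ ≤ p → 0ℚ ≤ q → 0ℚ ≤ p * q
  *-nonNeg {p} {q} 0≤p 0≤q = ℚ.nonNegative⁻¹ (p * q)
    {{ℚ.nonNeg*nonNeg⇒nonNeg p {{nonNegative 0≤p}} q {{nonNegative 0≤q}}}}

  *-mono-≤ : ∀ {p q r s} → 0ℚ ≤ r → 0ℚ ≤ q → p ≤ q → r ≤ s → p * r ≤ q * s
  *-mono-≤ {p} {q} {r} {s} 0≤r 0≤q p≤q r≤s = begin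
    p * r ≤⟨ ℚ.*-monoʳ-≤-nonNeg r {{nonNegative 0≤r}} p≤q ⟩
    q * r ≤⟨ ℚ.*-monoˡ-≤-nonNeg q {{nonNegative 0≤q}} r≤s ⟩
    q * s ∎

  p≤p+q : ∀ p {q} → 0ℚ ≤ q → p ≤ p + q
  p≤p+q p {q} 0≤q = subst (_≤ p + q) (ℚ.+-identityʳ p) (ℚ.+-monoʳ-≤ p 0≤q)

  p≤∣p∣ : ∀ p → p ≤ ∣ p ∣
  p≤∣p∣ p with ℚ.≤-total 0ℚ p
  ... | inj₁ 0≤p = ℚ.≤-reflexive (sym (ℚ.0≤p⇒∣p∣≡p 0≤p))
  ... | inj₂ p≤0 = ℚ.≤-trans p≤0 (ℚ.0≤∣p∣ p)

  p≤q+∣p-q∣ : ∀ p q → p ≤ q + ∣ p - q ∣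
  p≤q+∣p-q∣ p q = begin
    p               ≡⟨ solve 2 (λ p q → p := q :+ (p :- q)) refl p q ⟩
    q + (p - q)     ≤⟨ ℚ.+-monoʳ-≤ q (p≤∣p∣ (p - q)) ⟩
    q + ∣ p - q ∣   ∎

  p≤q+r⇒p-q≤r : ∀ {p} q {r} → p ≤ q + r → p - q ≤ r
  p≤q+r⇒p-q≤r {p} q {r} p≤q+r = begin
    p - q         ≤⟨ ℚ.+-monoˡ-≤ (- q) p≤q+r ⟩
    (q + r) - q   ≡⟨ solve 2 (λ q r → (q :+ r) :- q := r) refl q r ⟩
    r             ∎

  ∣-∣≤ : ∀ {p q r} → p ≤ q + r → q ≤ p + r → ∣ p - q ∣ ≤ r
  ∣-∣≤ {p} {q} {r} p≤ q≤ with ℚ.∣p∣≡p∨∣p∣≡-p (p - q)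
  ... | inj₁ eq = subst (_≤ r) (sym eq) (p≤q+r⇒p-q≤r q p≤)
  ... | inj₂ eq = subst (_≤ r)
    (sym (trans eq (solve 2 (λ p q → :- (p :- q) := q :- p) refl p q))) (p≤q+r⇒p-q≤r p q≤)

  square-cancel-≤ : ∀ {p q} → 0ℚ ≤ q → p * p ≤ q * q → p ≤ q
  square-cancel-≤ {p} {q} 0≤q p²≤q² = ℚ.≮⇒≥ λ q<p → ℚ.<-irrefl refl (begin-strict
    q * q   ≤⟨ ℚ.*-monoˡ-≤-nonNeg q {{nonNegative 0≤q}} (ℚ.<⇒≤ q<p) ⟩
    q * p   <⟨ ℚ.*-monoˡ-<-pos p {{positive (ℚ.≤-<-trans 0≤q q<p)}} q<p ⟩
    p * p   ≤⟨ p²≤q² ⟩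
    q * q   ∎)

  -- The quotient of positive rationals, with the positivity proof it needs.
  quotient : ∀ {ε K} → 0ℚ < ε → 0ℚ < K → ∃ λ δ → 0ℚ < δ × δ * K ≡ ε
  quotient {ε} {K} 0<ε 0<K =
    ε * 1/ K ,
    *-pos 0<ε (ℚ.positive⁻¹ (1/ K) {{ℚ.1/pos⇒pos K}}) ,
    trans (ℚ.*-assoc ε (1/ K) K)
      (trans (cong (ε *_) (ℚ.*-inverseˡ K)) (ℚ.*-identityʳ ε))
    where
      instance
        K-pos : Positive K
        K-pos = positive 0<K
        K-nonZero : NonZero K
        K-nonZero = ℚ.pos⇒nonZero K

  2⁻ : ℕ → ℚ
  2⁻ zero    = 1ℚ
  2⁻ (suc n) = ½ * 2⁻ n

  0≤2⁻ : ∀ n → 0ℚ ≤ 2⁻ n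
  0≤2⁻ zero    = ℚ.nonNegative⁻¹ 1ℚ
  0≤2⁻ (suc n) = *-nonNeg (ℚ.nonNegative⁻¹ ½) (0≤2⁻ n)

  fromℕ : ℕ → ℚ
  fromℕ zero    = 0ℚ
  fromℕ (suc n) = 1ℚ + fromℕ n

  0≤fromℕ : ∀ n → 0ℚ ≤ fromℕ n
  0≤fromℕ zero    = ℚ.≤-refl
  0≤fromℕ (suc n) = +-nonNeg (ℚ.nonNegative⁻¹ 1ℚ) (0≤fromℕ n)

  2⁻≤1 : ∀ n → 2⁻ n ≤ 1ℚ
  2⁻≤1 zero    = ℚ.≤-refl
  2⁻≤1 (suc n) = *-mono-≤ (0≤2⁻ n) (ℚ.nonNegative⁻¹ 1ℚ)
    (ℚ.≤ᵇ⇒≤ {½} {1ℚ} _) (2⁻≤1 n)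

  2⁻*n≤1 : ∀ n → 2⁻ n * fromℕ n ≤ 1ℚ
  2⁻*n≤1 zero    = ℚ.≤ᵇ⇒≤ {1ℚ * 0ℚ} {1ℚ} _
  2⁻*n≤1 (suc n) = begin
    (½ * 2⁻ n) * (1ℚ + fromℕ n)           ≡⟨ solve 3 (λ h t k →
      (h :* t) :* (con 1ℚ :+ k) := h :* t :+ h :* (t :* k)) refl ½ (2⁻ n) (fromℕ n) ⟩
    ½ * 2⁻ n + ½ * (2⁻ n * fromℕ n)       ≤⟨ ℚ.+-mono-≤
      (ℚ.*-monoˡ-≤-nonNeg ½ (2⁻≤1 n)) (ℚ.*-monoˡ-≤-nonNeg ½ (2⁻*n≤1 n)) ⟩
    ½ * 1ℚ + ½ * 1ℚ                       ≡⟨⟩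
    1ℚ                                    ∎

  2⁻-antitone : ∀ {m n} → m ℕ.≤ n → 2⁻ n ≤ 2⁻ m
  2⁻-antitone {n = n} z≤n       = 2⁻≤1 n
  2⁻-antitone         (s≤s m≤n) = ℚ.*-monoˡ-≤-nonNeg ½ (2⁻-antitone m≤n)

  toℚᵘ-fromℕ : ∀ n → toℚᵘ (fromℕ n) ℚᵘ.≃ mkℚᵘ (+ n) 0
  toℚᵘ-fromℕ zero    = ℚᵘ.≃-refl
  toℚᵘ-fromℕ (suc n) =
    ℚᵘ.≃-trans (ℚ.toℚᵘ-homo-+ 1ℚ (fromℕ n))
      (ℚᵘ.≃-trans (ℚᵘ.+-congʳ (toℚᵘ 1ℚ) (toℚᵘ-fromℕ n))
        (*≡* (cong (ℤ._* 1ℤ) (cong (λ k → 1ℤ ℤ.+ k) (ℤ.*-identityʳ (+ n))))))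

  archimedean : ∀ ε → 0ℚ < ε → ∃ λ n → 1ℚ ≤ ε * fromℕ n
  archimedean (mkℚ (ℤ.-[1+ _ ]) _ _) (*<* ())
  archimedean (mkℚ ℤ.+0 _ _) (*<* (ℤ.+<+ ()))
  archimedean ε@(mkℚ ℤ.+[1+ a ] d _) 0<ε = suc d , ℚ.toℚᵘ-cancel-≤
    (ℚᵘ.≤-respʳ-≃
      (ℚᵘ.≃-sym (ℚᵘ.≃-trans (ℚ.toℚᵘ-homo-* ε (fromℕ (suc d)))
        (ℚᵘ.*-congˡ {toℚᵘ ε} (toℚᵘ-fromℕ (suc d)))))
      (*≤* (ℤ.+≤+ (bound a d))))
    where
      bound : ∀ a d → 1 ℕ.* suc (ℕ.pred (suc d ℕ.* 1)) ℕ.≤ (suc a ℕ.* suc d) ℕ.* 1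
      bound a d = subst (ℕ._≤ (suc a ℕ.* suc d) ℕ.* 1)
        (sym (ℕ.*-identityˡ (suc d ℕ.* 1))) (ℕ.*-monoˡ-≤ 1 (ℕ.m≤m+n (suc d) (a ℕ.* suc d)))

  2⁻-null : ∀ {ε} → 0ℚ < ε → ∃ λ N → ∀ n → N ℕ.≤ n → 2⁻ n ≤ ε
  2⁻-null {ε} 0<ε with N , 1≤εN ← archimedean ε 0<ε = N , λ n N≤n → begin
    2⁻ n                      ≤⟨ 2⁻-antitone N≤n ⟩
    2⁻ N                      ≡⟨ ℚ.*-identityʳ (2⁻ N) ⟨
    2⁻ N * 1ℚ                 ≤⟨ ℚ.*-monoˡ-≤-nonNeg (2⁻ N) {{nonNegative (0≤2⁻ N)}} 1≤εN ⟩
    2⁻ N * (ε * fromℕ N)      ≡⟨ solve 3 (λ t e k → t :* (e :* k) := e :* (t :* k))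
                                   refl (2⁻ N) ε (fromℕ N) ⟩
    ε * (2⁻ N * fromℕ N)      ≤⟨ ℚ.*-monoˡ-≤-nonNeg ε {{nonNegative (ℚ.<⇒≤ 0<ε)}} (2⁻*n≤1 N) ⟩
    ε * 1ℚ                    ≡⟨ ℚ.*-identityʳ ε ⟩
    ε                         ∎

------------------------------------------------------------------------
-- Real numbers as Cauchy sequences of rationals.  The modulus is part of
-- the datum; equality of reals is the relation _≈ℝ_.

Cauchy : (ℕ → ℚ) → Set
Cauchy x = ∀ ε → 0ℚ ℚ.< ε →
  ∃ λ N → ∀ m n → N ℕ.≤ m → N ℕ.≤ n → ℚ.∣ x m ℚ.- x n ∣ ℚ.≤ ε

record ℝ : Set where
  constructor real
  field
    seq    : ℕ → ℚ
    cauchy : Cauchy seq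

open ℝ public

infix  4 _≈ℝ_ _<ℝ_
infixl 6 _+ℝ_
infixl 7 _*ℝ_
infix  8 -ℝ_

record _≈ℝ_ (x y : ℝ) : Set where
  constructor eventually
  field
    close : ∀ ε → 0ℚ ℚ.< ε →
      ∃ λ N → ∀ n → N ℕ.≤ n → ℚ.∣ seq x n ℚ.- seq y n ∣ ℚ.≤ ε

open _≈ℝ_ public

_<ℝ_ : ℝ → ℝ → Set
x <ℝ y = ∃ λ ε → 0ℚ ℚ.< ε ×
  ∃ λ N → ∀ n → N ℕ.≤ n → seq x n ℚ.+ ε ℚ.≤ seq y n

module CauchyClosure where
  open import Data.Rational
  open ℚ.≤-Reasoning
  open +-*-Solver
  open Rational

  abstract
    const-cauchy : ∀ q → Cauchy (λ _ → q)
    const-cauchy q ε 0<ε = 0 , λ _ _ _ _ → begin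
      ∣ q - q ∣   ≡⟨ cong ∣_∣ (ℚ.+-inverseʳ q) ⟩
      0ℚ          ≤⟨ ℚ.<⇒≤ 0<ε ⟩
      ε           ∎

    +-cauchy : ∀ x y → Cauchy x → Cauchy y → Cauchy (λ n → x n + y n)
    +-cauchy x y cx cy ε 0<ε
      with M , hx ← cx (ε * ½) (half-pos 0<ε)
         | N , hy ← cy (ε * ½) (half-pos 0<ε)
      = M ℕ.⊔ N , λ m n p q → begin
        ∣ (x m + y m) - (x n + y n) ∣       ≡⟨ cong ∣_∣ (solve 4 (λ a b c d →
          (a :+ b) :- (c :+ d) := (a :- c) :+ (b :- d)) refl (x m) (y m) (x n) (y n)) ⟩
        ∣ (x m - x n) + (y m - y n) ∣       ≤⟨ ℚ.∣p+q∣≤∣p∣+∣q∣ (x m - x n) (y m - y n) ⟩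
        ∣ x m - x n ∣ + ∣ y m - y n ∣       ≤⟨ ℚ.+-mono-≤
          (hx m n (ℕ.m⊔n≤o⇒m≤o M N p) (ℕ.m⊔n≤o⇒m≤o M N q))
          (hy m n (ℕ.m⊔n≤o⇒n≤o M N p) (ℕ.m⊔n≤o⇒n≤o M N q)) ⟩
        ε * ½ + ε * ½                       ≡⟨ halves ε ⟩
        ε                                   ∎

    neg-cauchy : ∀ x → Cauchy x → Cauchy (λ n → - x n)
    neg-cauchy x cx ε 0<ε with N , hx ← cx ε 0<ε = N , λ m n p q → begin
      ∣ - x m - - x n ∣   ≡⟨ cong ∣_∣ (solve 2 (λ a b → :- a :- :- b := b :- a) refl (x m) (x n)) ⟩
      ∣ x n - x m ∣       ≤⟨ hx n m q p ⟩
      ε                   ∎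

    bounded : ∀ x → Cauchy x → ∃ λ K → 0ℚ < K × ∃ λ N → ∀ n → N ℕ.≤ n → ∣ x n ∣ ≤ K
    bounded x cx with N , hx ← cx 1ℚ (ℚ.positive⁻¹ 1ℚ) =
      ∣ x N ∣ + 1ℚ ,
      ℚ.<-≤-trans (ℚ.positive⁻¹ 1ℚ)
        (subst (_≤ ∣ x N ∣ + 1ℚ) (ℚ.+-identityˡ 1ℚ) (ℚ.+-monoˡ-≤ 1ℚ (ℚ.0≤∣p∣ (x N)))) ,
      N , λ n N≤n → begin
        ∣ x n ∣                     ≡⟨ cong ∣_∣ (solve 2 (λ a b → a := b :+ (a :- b)) refl (x n) (x N)) ⟩
        ∣ x N + (x n - x N) ∣       ≤⟨ ℚ.∣p+q∣≤∣p∣+∣q∣ (x N) (x n - x N) ⟩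
        ∣ x N ∣ + ∣ x n - x N ∣     ≤⟨ ℚ.+-monoʳ-≤ ∣ x N ∣ (hx n N N≤n ℕ.≤-refl) ⟩
        ∣ x N ∣ + 1ℚ                ∎

    *-estimate : ∀ a b c d {δ η A B} → ∣ a - c ∣ ≤ δ → ∣ b - d ∣ ≤ η →
      ∣ b ∣ ≤ B → ∣ c ∣ ≤ A → ∣ a * b - c * d ∣ ≤ δ * B + η * A
    *-estimate a b c d {δ} {η} {A} {B} a-c b-d ∣b∣≤B ∣c∣≤A = begin
      ∣ a * b - c * d ∣                         ≡⟨ cong ∣_∣ (solve 4 (λ a b c d →
        a :* b :- c :* d := (a :- c) :* b :+ (b :- d) :* c) refl a b c d) ⟩
      ∣ (a - c) * b + (b - d) * c ∣             ≤⟨ ℚ.∣p+q∣≤∣p∣+∣q∣ ((a - c) * b) ((b - d) * c) ⟩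
      ∣ (a - c) * b ∣ + ∣ (b - d) * c ∣         ≡⟨ cong₂ _+_
        (ℚ.∣p*q∣≡∣p∣*∣q∣ (a - c) b) (ℚ.∣p*q∣≡∣p∣*∣q∣ (b - d) c) ⟩
      ∣ a - c ∣ * ∣ b ∣ + ∣ b - d ∣ * ∣ c ∣     ≤⟨ ℚ.+-mono-≤
        (*-mono-≤ (ℚ.0≤∣p∣ b) (ℚ.≤-trans (ℚ.0≤∣p∣ (a - c)) a-c) a-c ∣b∣≤B)
        (*-mono-≤ (ℚ.0≤∣p∣ c) (ℚ.≤-trans (ℚ.0≤∣p∣ (b - d)) b-d) b-d ∣c∣≤A) ⟩
      δ * B + η * A                             ∎

    *-cauchy : ∀ x y → Cauchy x → Cauchy y → Cauchy (λ n → x n * y n)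
    *-cauchy x y cx cy ε 0<ε =
      let A , 0<A , M₁ , bx = bounded x cx
          B , 0<B , M₂ , by = bounded y cy
          δ , 0<δ , δB≡ = quotient (half-pos 0<ε) 0<B
          η , 0<η , ηA≡ = quotient (half-pos 0<ε) 0<A
          M₃ , hx = cx δ 0<δ
          M₄ , hy = cy η 0<η
          M₁₂ = M₁ ℕ.⊔ M₂
          M₃₄ = M₃ ℕ.⊔ M₄
      in M₁₂ ℕ.⊔ M₃₄ , λ m n p q →
        let p₁₂ = ℕ.m⊔n≤o⇒m≤o M₁₂ M₃₄ p
            p₃₄ = ℕ.m⊔n≤o⇒n≤o M₁₂ M₃₄ p
            q₁₂ = ℕ.m⊔n≤o⇒m≤o M₁₂ M₃₄ q
            q₃₄ = ℕ.m⊔n≤o⇒n≤o M₁₂ M₃₄ q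
        in ℚ.≤-trans
          (*-estimate (x m) (y m) (x n) (y n)
            (hx m n (ℕ.m⊔n≤o⇒m≤o M₃ M₄ p₃₄) (ℕ.m⊔n≤o⇒m≤o M₃ M₄ q₃₄))
            (hy m n (ℕ.m⊔n≤o⇒n≤o M₃ M₄ p₃₄) (ℕ.m⊔n≤o⇒n≤o M₃ M₄ q₃₄))
            (by m (ℕ.m⊔n≤o⇒n≤o M₁ M₂ p₁₂))
            (bx n (ℕ.m⊔n≤o⇒m≤o M₁ M₂ q₁₂)))
          (ℚ.≤-reflexive (trans (cong₂ _+_ δB≡ ηA≡) (halves ε)))

fromℚ : ℚ → ℝ
fromℚ q = real (λ _ → q) (CauchyClosure.const-cauchy q)

0ℝ 1ℝ : ℝ
0ℝ = fromℚ 0ℚ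
1ℝ = fromℚ 1ℚ

_+ℝ_ _*ℝ_ : ℝ → ℝ → ℝ
x +ℝ y = real (λ n → seq x n ℚ.+ seq y n) (CauchyClosure.+-cauchy (seq x) (seq y) (cauchy x) (cauchy y))
x *ℝ y = real (λ n → seq x n ℚ.* seq y n) (CauchyClosure.*-cauchy (seq x) (seq y) (cauchy x) (cauchy y))

-ℝ_ : ℝ → ℝ
-ℝ x = real (λ n → ℚ.- seq x n) (CauchyClosure.neg-cauchy (seq x) (cauchy x))

------------------------------------------------------------------------
-- Square roots by bisection: for q ≥ 0, after n steps
-- root q n ² ≤ q ≤ (root q n + width q n) ²  with  width q n = (q + 1) / 2ⁿ.

width : ℚ → ℕ → ℚ
width q zero    = q ℚ.+ 1ℚ
width q (suc n) = ½ ℚ.* width q n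

bisect : (q lo mid : ℚ) → ℚ
bisect q lo mid with mid ℚ.* mid ℚ.≤? q
... | yes _ = mid
... | no  _ = lo

root : ℚ → ℕ → ℚ
root q zero    = 0ℚ
root q (suc n) = bisect q (root q n) (root q n ℚ.+ width q (suc n))

module Root where
  open import Data.Rational
  open ℚ.≤-Reasoning
  open +-*-Solver
  open Rational
  open CauchyClosure using (bounded)

  width≡ : ∀ q n → width q n ≡ 2⁻ n * (q + 1ℚ)
  width≡ q zero    = sym (ℚ.*-identityˡ (q + 1ℚ))
  width≡ q (suc n) = trans (cong (½ *_) (width≡ q n)) (sym (ℚ.*-assoc ½ (2⁻ n) (q + 1ℚ)))

  0≤width : ∀ {q} n → 0ℚ ≤ q → 0ℚ ≤ width q n
  0≤width {q} n 0≤q = subst (0ℚ ≤_) (sym (width≡ q n))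
    (*-nonNeg (0≤2⁻ n) (+-nonNeg 0≤q (ℚ.nonNegative⁻¹ 1ℚ)))

  0≤bisect : ∀ q lo mid → 0ℚ ≤ lo → 0ℚ ≤ mid → 0ℚ ≤ bisect q lo mid
  0≤bisect q lo mid 0≤lo 0≤mid with mid * mid ≤? q
  ... | yes _ = 0≤mid
  ... | no  _ = 0≤lo

  bisect²≤ : ∀ q lo mid → lo * lo ≤ q → bisect q lo mid * bisect q lo mid ≤ q
  bisect²≤ q lo mid lo²≤q with mid * mid ≤? q
  ... | yes mid²≤q = mid²≤q
  ... | no  _      = lo²≤q

  ≤[bisect+w]² : ∀ q lo mid w → mid ≡ lo + w → q ≤ (mid + w) * (mid + w) →
    q ≤ (bisect q lo mid + w) * (bisect q lo mid + w)
  ≤[bisect+w]² q lo mid w mid≡ q≤ with mid * mid ≤? q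
  ... | yes _      = q≤
  ... | no  mid²≰q = subst (λ t → q ≤ t * t) mid≡ (ℚ.<⇒≤ (ℚ.≰⇒> mid²≰q))

  0≤root : ∀ q n → 0ℚ ≤ q → 0ℚ ≤ root q n
  0≤root q zero    0≤q = ℚ.≤-refl
  0≤root q (suc n) 0≤q = 0≤bisect q (root q n) (root q n + width q (suc n)) (0≤root q n 0≤q)
    (+-nonNeg {root q n} {width q (suc n)} (0≤root q n 0≤q) (0≤width (suc n) 0≤q))

  root²≤ : ∀ q n → 0ℚ ≤ q → root q n * root q n ≤ q
  root²≤ q zero    0≤q = 0≤q
  root²≤ q (suc n) 0≤q =
    bisect²≤ q (root q n) (root q n + width q (suc n)) (root²≤ q n 0≤q)

  ≤[root+width]² : ∀ q n → 0ℚ ≤ q →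
    q ≤ (root q n + width q n) * (root q n + width q n)
  ≤[root+width]² q zero 0≤q = begin
    q                                   ≤⟨ p≤p+q q (+-nonNeg (*-nonNeg 0≤q 0≤q)
                                             (+-nonNeg 0≤q (ℚ.nonNegative⁻¹ 1ℚ))) ⟩
    q + (q * q + (q + 1ℚ))              ≡⟨ solve 1 (λ q → q :+ (q :* q :+ (q :+ con 1ℚ)) :=
                                             (con 0ℚ :+ (q :+ con 1ℚ)) :* (con 0ℚ :+ (q :+ con 1ℚ)))
                                             refl q ⟩
    (0ℚ + (q + 1ℚ)) * (0ℚ + (q + 1ℚ))   ∎
  ≤[root+width]² q (suc n) 0≤q =
    ≤[bisect+w]² q (root q n) (root q n + width q (suc n)) (width q (suc n)) refl
      (subst (λ t → q ≤ t * t) (eq (root q n) (width q n)) (≤[root+width]² q n 0≤q))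
    where
      eq : ∀ r w → r + w ≡ (r + ½ * w) + ½ * w
      eq = solve 2 (λ r w → r :+ w := (r :+ con ½ :* w) :+ con ½ :* w) refl

  0≤0⊔ : ∀ p → 0ℚ ≤ 0ℚ ⊔ p
  0≤0⊔ p = ℚ.p≤p⊔q 0ℚ p

  0⊔-lipschitz : ∀ p q → 0ℚ ⊔ p ≤ (0ℚ ⊔ q) + ∣ p - q ∣
  0⊔-lipschitz p q = ℚ.⊔-lub (+-nonNeg (0≤0⊔ q) (ℚ.0≤∣p∣ (p - q)))
    (ℚ.≤-trans (p≤q+∣p-q∣ p q) (ℚ.+-monoˡ-≤ ∣ p - q ∣ (ℚ.p≤q⊔p 0ℚ q)))

  root-step : ∀ {p q δ} m n → 0ℚ ≤ δ → ∣ p - q ∣ ≤ δ * δ → width (0ℚ ⊔ q) n ≤ δ →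
    root (0ℚ ⊔ p) m ≤ root (0ℚ ⊔ q) n + (δ + δ)
  root-step {p} {q} {δ} m n 0≤δ ∣p-q∣≤ w≤δ = square-cancel-≤
    (+-nonNeg 0≤s (+-nonNeg 0≤δ 0≤δ)) (begin
      root (0ℚ ⊔ p) m * root (0ℚ ⊔ p) m   ≤⟨ root²≤ (0ℚ ⊔ p) m (0≤0⊔ p) ⟩
      0ℚ ⊔ p                              ≤⟨ 0⊔-lipschitz p q ⟩
      (0ℚ ⊔ q) + ∣ p - q ∣                ≤⟨ ℚ.+-mono-≤ (≤[root+width]² (0ℚ ⊔ q) n (0≤0⊔ q)) ∣p-q∣≤ ⟩
      (s + w) * (s + w) + δ * δ           ≤⟨ ℚ.+-monoˡ-≤ (δ * δ) (*-mono-≤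
                                               (+-nonNeg 0≤s (0≤width n (0≤0⊔ q)))
                                               (+-nonNeg 0≤s 0≤δ) s+w≤ s+w≤) ⟩
      (s + δ) * (s + δ) + δ * δ           ≤⟨ p≤p+q _ (*-nonNeg (+-nonNeg 0≤s 0≤δ)
                                               (+-nonNeg 0≤δ 0≤δ)) ⟩
      (s + δ) * (s + δ) + δ * δ + (s + δ) * (δ + δ)
                                          ≡⟨ solve 2 (λ s d →
        (s :+ d) :* (s :+ d) :+ d :* d :+ (s :+ d) :* (d :+ d) :=
        (s :+ (d :+ d)) :* (s :+ (d :+ d))) refl s δ ⟩
      (s + (δ + δ)) * (s + (δ + δ))       ∎)
    where
      s w : ℚ
      s = root (0ℚ ⊔ q) n
      w = width (0ℚ ⊔ q) n
      0≤s : 0ℚ ≤ s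
      0≤s = 0≤root (0ℚ ⊔ q) n (0≤0⊔ q)
      s+w≤ : s + w ≤ s + δ
      s+w≤ = ℚ.+-monoʳ-≤ s w≤δ

  width≤ : ∀ q n {κ K} → 0ℚ ≤ κ → 0ℚ ≤ K → ∣ q ∣ ≤ K → 2⁻ n ≤ κ →
    width (0ℚ ⊔ q) n ≤ κ * (K + 1ℚ)
  width≤ q n {κ} {K} 0≤κ 0≤K ∣q∣≤K 2⁻ⁿ≤κ = begin
    width (0ℚ ⊔ q) n          ≡⟨ width≡ (0ℚ ⊔ q) n ⟩
    2⁻ n * ((0ℚ ⊔ q) + 1ℚ)    ≤⟨ *-mono-≤
      (+-nonNeg (0≤0⊔ q) (ℚ.nonNegative⁻¹ 1ℚ)) 0≤κ 2⁻ⁿ≤κ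
      (ℚ.+-monoˡ-≤ 1ℚ (ℚ.⊔-lub 0≤K (ℚ.≤-trans (p≤∣p∣ q) ∣q∣≤K))) ⟩
    κ * (K + 1ℚ)              ∎

  abstract
    √-cauchy : ∀ x → Cauchy x → Cauchy (λ n → root (0ℚ ⊔ x n) n)
    √-cauchy x cx ε 0<ε =
      let δ = ε * ½
          0<δ = half-pos 0<ε
          K , 0<K , M₁ , bx = bounded x cx
          0<K+1 = ℚ.<-≤-trans 0<K (p≤p+q K (ℚ.nonNegative⁻¹ 1ℚ))
          κ , 0<κ , κ[K+1]≡δ = quotient 0<δ 0<K+1
          M₂ , hx = cx (δ * δ) (*-pos 0<δ 0<δ)
          M₃ , h2 = 2⁻-null 0<κ
          M₂₃ = M₂ ℕ.⊔ M₃
          narrow = λ n (N≤n : M₁ ℕ.⊔ M₂₃ ℕ.≤ n) → subst (width (0ℚ ⊔ x n) n ≤_) κ[K+1]≡δ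
            (width≤ (x n) n (ℚ.<⇒≤ 0<κ) (ℚ.<⇒≤ 0<K) (bx n (ℕ.m⊔n≤o⇒m≤o M₁ M₂₃ N≤n))
              (h2 n (ℕ.m⊔n≤o⇒n≤o M₂ M₃ (ℕ.m⊔n≤o⇒n≤o M₁ M₂₃ N≤n))))
          close = λ m n (N≤m : M₁ ℕ.⊔ M₂₃ ℕ.≤ m) (N≤n : M₁ ℕ.⊔ M₂₃ ℕ.≤ n) →
            subst (λ t → root (0ℚ ⊔ x m) m ≤ root (0ℚ ⊔ x n) n + t) (halves ε)
              (root-step {x m} {x n} {δ} m n (ℚ.<⇒≤ 0<δ)
                (hx m n (ℕ.m⊔n≤o⇒m≤o M₂ M₃ (ℕ.m⊔n≤o⇒n≤o M₁ M₂₃ N≤m))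
                        (ℕ.m⊔n≤o⇒m≤o M₂ M₃ (ℕ.m⊔n≤o⇒n≤o M₁ M₂₃ N≤n)))
                (narrow n N≤n))
      in M₁ ℕ.⊔ M₂₃ , λ m n p q →
         ∣-∣≤ {root (0ℚ ⊔ x m) m} {root (0ℚ ⊔ x n) n} {ε} (close m n p q) (close n m q p)

-- The square root of max(x, 0).
√_ : ℝ → ℝ
√ x = real (λ n → root (0ℚ ℚ.⊔ seq x n) n) (Root.√-cauchy (seq x) (cauchy x))

------------------------------------------------------------------------
-- Complex numbers

infix  4 _≈_
infixl 6 _+_
infixl 7 _*_
infix  8 -_

record ℂ : Set where
  constructor _+i_
  field
    re im : ℝ

open ℂ public

record _≈_ (z w : ℂ) : Set where
  constructor componentwise
  field
    re-≈ : re z ≈ℝ re w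
    im-≈ : im z ≈ℝ im w

open _≈_ public

fromℝ : ℝ → ℂ
fromℝ x = x +i 0ℝ

fromℤ : ℤ → ℂ
fromℤ k = fromℝ (fromℚ (k ℚ./ 1))

0ℂ 1ℂ : ℂ
0ℂ = fromℝ 0ℝ
1ℂ = fromℝ 1ℝ

_+_ _*_ : ℂ → ℂ → ℂ
-_ conj : ℂ → ℂ
(a +i b) + (c +i d) = (a +ℝ c) +i (b +ℝ d)
(a +i b) * (c +i d) = (a *ℝ c +ℝ -ℝ (b *ℝ d)) +i (a *ℝ d +ℝ b *ℝ c)
- (a +i b)          = (-ℝ a) +i (-ℝ b)
conj (a +i b)       = a +i (-ℝ b)

∣_∣ : ℂ → ℝ
∣ a +i b ∣ = √ (a *ℝ a +ℝ b *ℝ b)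

Unit : ℂ → Set
Unit = Invertible _≈_ 1ℂ _*_

-- Division takes the invertibility of the denominator as an argument; up to
-- _≈_ the quotient does not depend on which inverse is supplied.
_/_[_] : (z w : ℂ) → Unit w → ℂ
z / w [ w⁻¹ , _ ] = z * w⁻¹

------------------------------------------------------------------------
-- Laurent polynomials over ℂ: the list (a₁ , k₁) ∷ … ∷ (aₘ , kₘ) ∷ []
-- stands for a₁ z^k₁ + … + aₘ z^kₘ.  Exponents may repeat, so equality is
-- equality of all coefficients.

infix  4 _≋_
infixl 6 _⊕_
infixl 7 _⊛_ _·_

Laurent : Set
Laurent = List (ℂ × ℤ)

coeff : Laurent → ℤ → ℂ
coeff []            k = 0ℂ
coeff ((a , i) ∷ f) k = if does (i ℤ.≟ k) then a + coeff f k else coeff f k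

record _≋_ (f g : Laurent) : Set where
  constructor coeffwise
  field
    coeff-≈ : ∀ k → coeff f k ≈ coeff g k

open _≋_ public

z^_ : ℤ → Laurent
z^ k = (1ℂ , k) ∷ []

_⊕_ _⊛_ : Laurent → Laurent → Laurent
f ⊕ g = f ++ g
f ⊛ g = cartesianProductWith (λ (a , i) (b , j) → a * b , i ℤ.+ j) f g

_·_ : ℂ → Laurent → Laurent
c · f = map (map₁ (c *_)) f

-- f̄(1/z), where f̄ conjugates the coefficients of f.
conj[1/z] : Laurent → Laurent
conj[1/z] = map (λ (a , k) → conj a , ℤ.- k)

-- f*(z) = zⁿ f̄(1/z) for a polynomial f of degree n.
reversed : ℕ → Laurent → Laurent
reversed n f = z^ (+ n) ⊛ conj[1/z] f

Φ : (ℕ → ℂ) → ℕ → Laurent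
Φ α zero    = z^ 0ℤ
Φ α (suc n) = z^ 1ℤ ⊛ Φ α n ⊕ (- conj (α n)) · reversed n (Φ α n)

record IsLinear (F : Laurent → ℂ) : Set where
  field
    respects : ∀ {f g} → f ≋ g → F f ≈ F g
    additive : ∀ f g → F (f ⊕ g) ≈ F f + F g
    scales   : ∀ c f → F (c · f) ≈ c * F f

record OPUC : Set where
  field
    α            : ℕ → ℂ
    ∣α∣<1        : ∀ n → ∣ α n ∣ <ℝ 1ℝ
    𝓛            : Laurent → ℂ
    𝓛-linear     : IsLinear 𝓛
    𝓛-normalised : 𝓛 (z^ 0ℤ) ≈ 1ℂ
    𝓛-orthogonal : ∀ m n → m ≢ n → 𝓛 (Φ α m ⊛ conj[1/z] (Φ α n)) ≈ 0ℂ

  ᾱ β : ℕ → ℂ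
  ᾱ j = conj (α j)
  β j = - ᾱ j

  ⟨_,_⟩ : Laurent → Laurent → ℂ
  ⟨ f , g ⟩ = 𝓛 (f ⊛ conj[1/z] g)

  ∥Φ∥² : ℕ → ℂ
  ∥Φ∥² s = ⟨ Φ α s , Φ α s ⟩

  -- ∏_{j<s} (1 − |αⱼ|²)
  ∏[1-∣α∣²] : ℕ → ℝ
  ∏[1-∣α∣²] zero    = 1ℝ
  ∏[1-∣α∣²] (suc s) = ∏[1-∣α∣²] s *ℝ (1ℝ +ℝ -ℝ (∣ α s ∣ *ℝ ∣ α s ∣))

  -- The first argument only supplies the divisions by ⟨Φ_s , Φ_s⟩.
  μ : (∀ s → Unit (∥Φ∥² s)) → ℤ → ℕ → ℕ → ℂ
  μ unit n r s = ⟨ Φ α s , z^ n ⊛ Φ α r ⟩ / ∥Φ∥² s [ unit s ]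

------------------------------------------------------------------------
-- Polynomials over ℤ in commuting variables X, as sums of terms c · x₁⋯xₘ.
-- The terms need not have distinct monomials; when every term has a positive
-- coefficient, so does the polynomial after collecting like terms.

Polynomial : Set → Set
Polynomial X = List (ℤ × List X)

module _ {X : Set} (ρ : X → ℂ) where

  evalMonomial : List X → ℂ
  evalMonomial = foldr (λ x z → ρ x * z) 1ℂ

  eval : Polynomial X → ℂ
  eval = foldr (λ (c , m) z → fromℤ c * evalMonomial m + z) 0ℂ

PositiveCoefficients : {X : Set} → Polynomial X → Set
PositiveCoefficients = All (λ (c , _) → 0ℤ ℤ.< c)

{-# OPTIONS --safe #-}

-- Put M n r s = ⟨Φ_s , zⁿΦ_r⟩ and M* n r s = ⟨Φ_s , zⁿΦ*_r⟩.  The Szegő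
-- recursion and its reversal give, without any sign,
--   M (n+1) r s = M n (r+1) s + α_r M* n r s,
--   M* n (r+1) s = M* n r s + β_r M (n+1) r s,
-- and orthogonality gives M 0 r s = δ_rs ⟨Φ_s , Φ_s⟩.  Hence M n r s is
-- ⟨Φ_s , Φ_s⟩ times a sum of monomials in α_j, β_j with j < n + r.
-- The functional f ↦ conj 𝓛(f̄(1/z)) satisfies the same hypotheses as 𝓛, so the
-- two agree on every z⁻ⁿ; the pairing is therefore Hermitian, and reciprocity
-- follows by moving zⁿ to the other argument.  The norms are positive because
-- ⟨Φ_{s+1} , Φ_{s+1}⟩ = ⟨Φ_s , Φ_s⟩ (1 + α_s β_s).
module Submission where

open import Algebra.Bundles using (CommutativeRing; CommutativeSemiring)
open import Algebra.Consequences.Setoid using (comm∧idˡ⇒id; comm∧invʳ⇒inv; comm∧distrʳ⇒distr)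
import Algebra.Properties.Ring as RingProperties
import Algebra.Solver.Ring.NaturalCoefficients.Default as SemiringSolver
open import Algebra.Structures.Biased using (IsCommutativeMonoidˡ; IsCommutativeSemiringˡ)
open import Data.Bool using (true; false; if_then_else_)
open import Data.Fin using (Fin; toℕ; fromℕ<)
import Data.Fin.Properties as Fin
open import Data.Integer as ℤ using (ℤ; +_; 0ℤ; 1ℤ) renaming (-_ to -ℤ_)
import Data.Integer.Properties as ℤ
open import Data.List using (List; []; _∷_; _++_; map; cartesianProductWith; foldr)
import Data.List.Relation.Unary.All as All
import Data.List.Relation.Unary.All.Properties as All
open import Data.Nat as ℕ using (ℕ; zero; suc) renaming (_+_ to _+ℕ_)
import Data.Nat.Properties as ℕ
open import Data.Product using (_×_; _,_; proj₁; proj₂; map₁; ∃; ∃-syntax; Σ-syntax)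
open import Data.Rational as ℚ using (ℚ; 0ℚ; 1ℚ; ½)
import Data.Rational.Properties as ℚ
open import Data.Rational.Solver using (module +-*-Solver)
open import Data.Sum as Sum using (_⊎_; inj₁; inj₂; [_,_])
open import Function using (_∘_)
open import Level using (_⊔_; 0ℓ)
open import Relation.Binary.Bundles using (Setoid)
open import Relation.Binary.PropositionalEquality as ≡ using (_≡_; _≢_)
import Relation.Binary.Reasoning.Setoid as SetoidReasoning
open import Relation.Binary.Structures using (IsEquivalence)
open import Relation.Nullary using (yes; no; does)
open import Relation.Nullary.Decidable using (dec-true; dec-false)

-- No sign appears because the recursion is read in the antilinear argument: zΦ_r = Φ_{r+1} +
-- conj(α_r) Φ*_r contributes α_r, and Φ*_{r+1} = Φ*_r - α_r zΦ_r contributes -conj(α_r) = β_r. One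
-- polynomial has to serve all sequences α at once. The coefficients are therefore computed by a
-- recursion `Q` in which no functional occurs, and their monomials are extracted for the whole
-- family of systems simultaneously. The argument is carried out over a commutative ring `K` and a
-- commutative semiring `A`, both with an involution. `A` stands for the Laurent polynomials, whose
-- lists of terms form a semiring, so every minus sign is kept in `K`. The condition |α_j| < 1
-- enters through the invertibility of the norms: a Cauchy real is inverted by means of a positive
-- lower bound, and 1 - |α_j|² inherits one from the gap in |α_j| < 1.

-- Involutions of commutative semirings.

record Involution {c ℓ} (R : CommutativeSemiring c ℓ) : Set (c ⊔ ℓ) where
  open CommutativeSemiring R
  open SetoidReasoning setoid
  infix 9 _⋆
  field
    _⋆           : Carrier → Carrier
    ⋆-cong       : ∀ {x y} → x ≈ y → x ⋆ ≈ y ⋆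
    ⋆-+          : ∀ x y → (x + y) ⋆ ≈ x ⋆ + y ⋆
    ⋆-*          : ∀ x y → (x * y) ⋆ ≈ x ⋆ * y ⋆
    ⋆-involutive : ∀ x → x ⋆ ⋆ ≈ x

  -- A semiring has no cancellation; involutivity replaces it, by writing the neutral element as its
  -- own double image so that the homomorphism law applies. The same device gives the unit.
  ⋆-0# : 0# ⋆ ≈ 0#
  ⋆-0# = begin
    0# ⋆              ≈⟨ +-identityˡ (0# ⋆) ⟨
    0# + 0# ⋆         ≈⟨ +-congʳ (⋆-involutive 0#) ⟨
    0# ⋆ ⋆ + 0# ⋆     ≈⟨ ⋆-+ (0# ⋆) 0# ⟨
    (0# ⋆ + 0#) ⋆     ≈⟨ ⋆-cong (+-identityʳ (0# ⋆)) ⟩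
    0# ⋆ ⋆            ≈⟨ ⋆-involutive 0# ⟩
    0#                ∎

  ⋆-1# : 1# ⋆ ≈ 1#
  ⋆-1# = begin
    1# ⋆              ≈⟨ *-identityˡ (1# ⋆) ⟨
    1# * 1# ⋆         ≈⟨ *-congʳ (⋆-involutive 1#) ⟨
    1# ⋆ ⋆ * 1# ⋆     ≈⟨ ⋆-* (1# ⋆) 1# ⟨
    (1# ⋆ * 1#) ⋆     ≈⟨ ⋆-cong (*-identityʳ (1# ⋆)) ⟩
    1# ⋆ ⋆            ≈⟨ ⋆-involutive 1# ⟩
    1#                ∎

-- A Laurent polynomial f = Σ aᵢ z^kᵢ is studied through its pairings
-- ⟦ f ⟧ φ = Σ aᵢ φ(kᵢ) with all functions φ on the exponents: the ring laws
-- become interchanges of finite sums, and no coefficients are collected.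
module LaurentAlgebra {c ℓ} (K : CommutativeSemiring c ℓ) (conjugation : Involution K) where
  open CommutativeSemiring K
  open Involution conjugation
  open SetoidReasoning setoid
  open SemiringSolver K using (solve; _:+_; _:*_; _:=_)

  infix  4 _≐_
  infixl 7 _⊛_

  Laurent : Set c
  Laurent = List (Carrier × ℤ)

  ⟦_⟧ : Laurent → (ℤ → Carrier) → Carrier
  ⟦ []          ⟧ φ = 0#
  ⟦ (a , k) ∷ f ⟧ φ = a * φ k + ⟦ f ⟧ φ

  record _≐_ (f g : Laurent) : Set (c ⊔ ℓ) where
    constructor pairingwise
    field
      pairing-≈ : ∀ φ → ⟦ f ⟧ φ ≈ ⟦ g ⟧ φ

  open _≐_ public

  -- This and the next three definitions repeat over `K` the bodies used in the theorem, so that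
  -- over ℂ they agree with those by computation.
  _⊛_ : Laurent → Laurent → Laurent
  f ⊛ g = cartesianProductWith (λ (a , i) (b , j) → a * b , i ℤ.+ j) f g

  _★ : Laurent → Laurent
  _★ = map (λ (a , k) → a ⋆ , ℤ.- k)

  ι : Carrier → Laurent
  ι a = (a , 0ℤ) ∷ []

  z^_ : ℤ → Laurent
  z^ k = (1# , k) ∷ []

  -- Calculus of the pairings.

  ⟦⟧-cong : ∀ f {φ ψ} → (∀ k → φ k ≈ ψ k) → ⟦ f ⟧ φ ≈ ⟦ f ⟧ ψ
  ⟦⟧-cong []            φ≈ψ = refl
  ⟦⟧-cong ((a , k) ∷ f) φ≈ψ = +-cong (*-congˡ (φ≈ψ k)) (⟦⟧-cong f φ≈ψ)

  ⟦⟧-zero : ∀ f → ⟦ f ⟧ (λ _ → 0#) ≈ 0#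
  ⟦⟧-zero []            = refl
  ⟦⟧-zero ((a , k) ∷ f) = trans (+-cong (zeroʳ a) (⟦⟧-zero f)) (+-identityʳ 0#)

  ⟦⟧-+ : ∀ f φ ψ → ⟦ f ⟧ (λ k → φ k + ψ k) ≈ ⟦ f ⟧ φ + ⟦ f ⟧ ψ
  ⟦⟧-+ []            φ ψ = sym (+-identityʳ 0#)
  ⟦⟧-+ ((a , k) ∷ f) φ ψ = trans (+-congˡ (⟦⟧-+ f φ ψ))
    (solve 5 (λ a x y p q → a :* (x :+ y) :+ (p :+ q) := (a :* x :+ p) :+ (a :* y :+ q))
      refl a (φ k) (ψ k) (⟦ f ⟧ φ) (⟦ f ⟧ ψ))

  ⟦⟧-* : ∀ f b φ → ⟦ f ⟧ (λ k → b * φ k) ≈ b * ⟦ f ⟧ φ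
  ⟦⟧-* []            b φ = sym (zeroʳ b)
  ⟦⟧-* ((a , k) ∷ f) b φ = trans (+-congˡ (⟦⟧-* f b φ))
    (solve 4 (λ a b x p → a :* (b :* x) :+ b :* p := b :* (a :* x :+ p))
      refl a b (φ k) (⟦ f ⟧ φ))

  -- Fubini for finite sums. Commutativity of `⊛` is the case `χ i j = φ (i + j)`.
  ⟦⟧-swap : ∀ f g (χ : ℤ → ℤ → Carrier) →
    ⟦ f ⟧ (λ i → ⟦ g ⟧ (χ i)) ≈ ⟦ g ⟧ (λ j → ⟦ f ⟧ (λ i → χ i j))
  ⟦⟧-swap []            g χ = sym (⟦⟧-zero g)
  ⟦⟧-swap ((a , k) ∷ f) g χ = begin
    a * ⟦ g ⟧ (χ k) + ⟦ f ⟧ (λ i → ⟦ g ⟧ (χ i))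
      ≈⟨ +-cong (sym (⟦⟧-* g a (χ k))) (⟦⟧-swap f g χ) ⟩
    ⟦ g ⟧ (λ j → a * χ k j) + ⟦ g ⟧ (λ j → ⟦ f ⟧ (λ i → χ i j))
      ≈⟨ ⟦⟧-+ g (λ j → a * χ k j) (λ j → ⟦ f ⟧ (λ i → χ i j)) ⟨
    ⟦ g ⟧ (λ j → a * χ k j + ⟦ f ⟧ (λ i → χ i j)) ∎

  ⟦++⟧ : ∀ f g φ → ⟦ f ++ g ⟧ φ ≈ ⟦ f ⟧ φ + ⟦ g ⟧ φ
  ⟦++⟧ []            g φ = sym (+-identityˡ (⟦ g ⟧ φ))
  ⟦++⟧ ((a , k) ∷ f) g φ = trans (+-congˡ (⟦++⟧ f g φ))
    (sym (+-assoc (a * φ k) (⟦ f ⟧ φ) (⟦ g ⟧ φ)))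

  ⟦monomial⊛⟧ : ∀ a i g φ →
    ⟦ map (λ (b , j) → a * b , i ℤ.+ j) g ⟧ φ ≈ a * ⟦ g ⟧ (λ j → φ (i ℤ.+ j))
  ⟦monomial⊛⟧ a i []            φ = sym (zeroʳ a)
  ⟦monomial⊛⟧ a i ((b , j) ∷ g) φ = trans (+-congˡ (⟦monomial⊛⟧ a i g φ))
    (solve 4 (λ a b x p → a :* b :* x :+ a :* p := a :* (b :* x :+ p))
      refl a b (φ (i ℤ.+ j)) (⟦ g ⟧ (λ j → φ (i ℤ.+ j))))

  ⟦⊛⟧ : ∀ f g φ → ⟦ f ⊛ g ⟧ φ ≈ ⟦ f ⟧ (λ i → ⟦ g ⟧ (λ j → φ (i ℤ.+ j)))
  ⟦⊛⟧ []            g φ = refl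
  ⟦⊛⟧ ((a , i) ∷ f) g φ =
    trans (⟦++⟧ (map (λ (b , j) → a * b , i ℤ.+ j) g) (f ⊛ g) φ)
      (+-cong (⟦monomial⊛⟧ a i g φ) (⟦⊛⟧ f g φ))

  -- `★` conjugates coefficients, so it cannot be moved onto `φ` alone: the outer `⋆` restores
  -- linearity in `φ`.
  ⟦★⟧ : ∀ f φ → ⟦ f ★ ⟧ φ ≈ (⟦ f ⟧ (λ k → φ (ℤ.- k) ⋆)) ⋆
  ⟦★⟧ []            φ = sym ⋆-0#
  ⟦★⟧ ((a , k) ∷ f) φ = sym (begin
    (a * φ (ℤ.- k) ⋆ + ⟦ f ⟧ (λ k → φ (ℤ.- k) ⋆)) ⋆
      ≈⟨ ⋆-+ (a * φ (ℤ.- k) ⋆) (⟦ f ⟧ (λ k → φ (ℤ.- k) ⋆)) ⟩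
    (a * φ (ℤ.- k) ⋆) ⋆ + (⟦ f ⟧ (λ k → φ (ℤ.- k) ⋆)) ⋆
      ≈⟨ +-cong (trans (⋆-* a (φ (ℤ.- k) ⋆)) (*-congˡ (⋆-involutive (φ (ℤ.- k)))))
                (sym (⟦★⟧ f φ)) ⟩
    a ⋆ * φ (ℤ.- k) + ⟦ f ★ ⟧ φ ∎)

  ⟦ι⟧ : ∀ a φ → ⟦ ι a ⟧ φ ≈ a * φ 0ℤ
  ⟦ι⟧ a φ = +-identityʳ (a * φ 0ℤ)

  ⟦z^⟧ : ∀ k φ → ⟦ z^ k ⟧ φ ≈ φ k
  ⟦z^⟧ k φ = trans (+-identityʳ (1# * φ k)) (*-identityˡ (φ k))

  ⟦ι⊛⟧ : ∀ a f φ → ⟦ ι a ⊛ f ⟧ φ ≈ a * ⟦ f ⟧ φ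
  ⟦ι⊛⟧ a f φ = begin
    ⟦ ι a ⊛ f ⟧ φ                         ≈⟨ ⟦⊛⟧ (ι a) f φ ⟩
    ⟦ ι a ⟧ (λ i → ⟦ f ⟧ (λ j → φ (i ℤ.+ j))) ≈⟨ ⟦ι⟧ a (λ i → ⟦ f ⟧ (λ j → φ (i ℤ.+ j))) ⟩
    a * ⟦ f ⟧ (λ j → φ (0ℤ ℤ.+ j))        ≈⟨ *-congˡ (⟦⟧-cong f λ j → reflexive (≡.cong φ (ℤ.+-identityˡ j))) ⟩
    a * ⟦ f ⟧ φ                           ∎

  ⟦·⟧ : ∀ a f φ → ⟦ map (map₁ (a *_)) f ⟧ φ ≈ a * ⟦ f ⟧ φ
  ⟦·⟧ a []            φ = sym (zeroʳ a)
  ⟦·⟧ a ((b , k) ∷ f) φ = trans (+-congˡ (⟦·⟧ a f φ))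
    (solve 4 (λ a b x p → a :* b :* x :+ a :* p := a :* (b :* x :+ p))
      refl a b (φ k) (⟦ f ⟧ φ))

  ·≐ι⊛ : ∀ a f → map (map₁ (a *_)) f ≐ ι a ⊛ f
  ·≐ι⊛ a f = pairingwise λ φ → trans (⟦·⟧ a f φ) (sym (⟦ι⊛⟧ a f φ))

  -- The semiring of Laurent polynomials and its involution.

  ++-cong : ∀ {f f′ g g′} → f ≐ f′ → g ≐ g′ → f ++ g ≐ f′ ++ g′
  ++-cong {f} {f′} {g} {g′} f≐f′ g≐g′ = pairingwise λ φ → begin
    ⟦ f ++ g ⟧ φ          ≈⟨ ⟦++⟧ f g φ ⟩
    ⟦ f ⟧ φ + ⟦ g ⟧ φ     ≈⟨ +-cong (pairing-≈ f≐f′ φ) (pairing-≈ g≐g′ φ) ⟩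
    ⟦ f′ ⟧ φ + ⟦ g′ ⟧ φ   ≈⟨ ⟦++⟧ f′ g′ φ ⟨
    ⟦ f′ ++ g′ ⟧ φ        ∎

  ++-assoc : ∀ f g h → (f ++ g) ++ h ≐ f ++ (g ++ h)
  ++-assoc f g h = pairingwise λ φ → begin
    ⟦ (f ++ g) ++ h ⟧ φ             ≈⟨ ⟦++⟧ (f ++ g) h φ ⟩
    ⟦ f ++ g ⟧ φ + ⟦ h ⟧ φ          ≈⟨ +-congʳ (⟦++⟧ f g φ) ⟩
    ⟦ f ⟧ φ + ⟦ g ⟧ φ + ⟦ h ⟧ φ     ≈⟨ +-assoc (⟦ f ⟧ φ) (⟦ g ⟧ φ) (⟦ h ⟧ φ) ⟩
    ⟦ f ⟧ φ + (⟦ g ⟧ φ + ⟦ h ⟧ φ)   ≈⟨ +-congˡ (⟦++⟧ g h φ) ⟨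
    ⟦ f ⟧ φ + ⟦ g ++ h ⟧ φ          ≈⟨ ⟦++⟧ f (g ++ h) φ ⟨
    ⟦ f ++ (g ++ h) ⟧ φ             ∎

  ++-comm : ∀ f g → f ++ g ≐ g ++ f
  ++-comm f g = pairingwise λ φ → begin
    ⟦ f ++ g ⟧ φ        ≈⟨ ⟦++⟧ f g φ ⟩
    ⟦ f ⟧ φ + ⟦ g ⟧ φ   ≈⟨ +-comm (⟦ f ⟧ φ) (⟦ g ⟧ φ) ⟩
    ⟦ g ⟧ φ + ⟦ f ⟧ φ   ≈⟨ ⟦++⟧ g f φ ⟨
    ⟦ g ++ f ⟧ φ        ∎

  ⊛-comm : ∀ f g → f ⊛ g ≐ g ⊛ f
  ⊛-comm f g = pairingwise λ φ → begin
    ⟦ f ⊛ g ⟧ φ                                 ≈⟨ ⟦⊛⟧ f g φ ⟩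
    ⟦ f ⟧ (λ i → ⟦ g ⟧ (λ j → φ (i ℤ.+ j)))     ≈⟨ ⟦⟧-swap f g (λ i j → φ (i ℤ.+ j)) ⟩
    ⟦ g ⟧ (λ j → ⟦ f ⟧ (λ i → φ (i ℤ.+ j)))     ≈⟨ ⟦⟧-cong g (λ j → ⟦⟧-cong f λ i → reflexive (≡.cong φ (ℤ.+-comm i j))) ⟩
    ⟦ g ⟧ (λ j → ⟦ f ⟧ (λ i → φ (j ℤ.+ i)))     ≈⟨ ⟦⊛⟧ g f φ ⟨
    ⟦ g ⊛ f ⟧ φ                                 ∎

  ⊛-cong : ∀ {f f′ g g′} → f ≐ f′ → g ≐ g′ → f ⊛ g ≐ f′ ⊛ g′
  ⊛-cong {f} {f′} {g} {g′} f≐f′ g≐g′ = pairingwise λ φ → begin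
    ⟦ f ⊛ g ⟧ φ                                 ≈⟨ ⟦⊛⟧ f g φ ⟩
    ⟦ f ⟧ (λ i → ⟦ g ⟧ (λ j → φ (i ℤ.+ j)))     ≈⟨ ⟦⟧-cong f (λ i → pairing-≈ g≐g′ (λ j → φ (i ℤ.+ j))) ⟩
    ⟦ f ⟧ (λ i → ⟦ g′ ⟧ (λ j → φ (i ℤ.+ j)))    ≈⟨ pairing-≈ f≐f′ (λ i → ⟦ g′ ⟧ (λ j → φ (i ℤ.+ j))) ⟩
    ⟦ f′ ⟧ (λ i → ⟦ g′ ⟧ (λ j → φ (i ℤ.+ j)))   ≈⟨ ⟦⊛⟧ f′ g′ φ ⟨
    ⟦ f′ ⊛ g′ ⟧ φ                               ∎

  ⊛-assoc : ∀ f g h → (f ⊛ g) ⊛ h ≐ f ⊛ (g ⊛ h)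
  ⊛-assoc f g h = pairingwise λ φ → begin
    ⟦ (f ⊛ g) ⊛ h ⟧ φ
      ≈⟨ ⟦⊛⟧ (f ⊛ g) h φ ⟩
    ⟦ f ⊛ g ⟧ (λ l → ⟦ h ⟧ (λ k → φ (l ℤ.+ k)))
      ≈⟨ ⟦⊛⟧ f g (λ l → ⟦ h ⟧ (λ k → φ (l ℤ.+ k))) ⟩
    ⟦ f ⟧ (λ i → ⟦ g ⟧ (λ j → ⟦ h ⟧ (λ k → φ ((i ℤ.+ j) ℤ.+ k))))
      ≈⟨ ⟦⟧-cong f (λ i → ⟦⟧-cong g λ j → ⟦⟧-cong h λ k → reflexive (≡.cong φ (ℤ.+-assoc i j k))) ⟩
    ⟦ f ⟧ (λ i → ⟦ g ⟧ (λ j → ⟦ h ⟧ (λ k → φ (i ℤ.+ (j ℤ.+ k)))))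
      ≈⟨ ⟦⟧-cong f (λ i → ⟦⊛⟧ g h (λ l → φ (i ℤ.+ l))) ⟨
    ⟦ f ⟧ (λ i → ⟦ g ⊛ h ⟧ (λ l → φ (i ℤ.+ l)))
      ≈⟨ ⟦⊛⟧ f (g ⊛ h) φ ⟨
    ⟦ f ⊛ (g ⊛ h) ⟧ φ ∎

  ⊛-identityˡ : ∀ f → z^ 0ℤ ⊛ f ≐ f
  ⊛-identityˡ f = pairingwise λ φ → trans (⟦ι⊛⟧ 1# f φ) (*-identityˡ (⟦ f ⟧ φ))

  ⊛-distribʳ-++ : ∀ h f g → (f ++ g) ⊛ h ≐ f ⊛ h ++ g ⊛ h
  ⊛-distribʳ-++ h f g = pairingwise λ φ → begin
    ⟦ (f ++ g) ⊛ h ⟧ φ                              ≈⟨ ⟦⊛⟧ (f ++ g) h φ ⟩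
    ⟦ f ++ g ⟧ (λ i → ⟦ h ⟧ (λ j → φ (i ℤ.+ j)))    ≈⟨ ⟦++⟧ f g (λ i → ⟦ h ⟧ (λ j → φ (i ℤ.+ j))) ⟩
    ⟦ f ⟧ (λ i → ⟦ h ⟧ (λ j → φ (i ℤ.+ j))) + ⟦ g ⟧ (λ i → ⟦ h ⟧ (λ j → φ (i ℤ.+ j)))
                                                    ≈⟨ +-cong (⟦⊛⟧ f h φ) (⟦⊛⟧ g h φ) ⟨
    ⟦ f ⊛ h ⟧ φ + ⟦ g ⊛ h ⟧ φ                       ≈⟨ ⟦++⟧ (f ⊛ h) (g ⊛ h) φ ⟨
    ⟦ f ⊛ h ++ g ⊛ h ⟧ φ                            ∎

  laurentSemiring : CommutativeSemiring c (c ⊔ ℓ)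
  laurentSemiring = record
    { Carrier = Laurent
    ; _≈_ = _≐_
    ; _+_ = _++_
    ; _*_ = _⊛_
    ; 0# = []
    ; 1# = z^ 0ℤ
    ; isCommutativeSemiring = IsCommutativeSemiringˡ.isCommutativeSemiring record
      { +-isCommutativeMonoid = IsCommutativeMonoidˡ.isCommutativeMonoid record
        { isSemigroup = record
          { isMagma = record { isEquivalence = ≐-isEquivalence ; ∙-cong = ++-cong }
          ; assoc = ++-assoc }
        ; identityˡ = λ f → pairingwise λ φ → refl
        ; comm = ++-comm }
      ; *-isCommutativeMonoid = IsCommutativeMonoidˡ.isCommutativeMonoid record
        { isSemigroup = record
          { isMagma = record { isEquivalence = ≐-isEquivalence ; ∙-cong = ⊛-cong }
          ; assoc = ⊛-assoc }
        ; identityˡ = ⊛-identityˡ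
        ; comm = ⊛-comm }
      ; distribʳ = ⊛-distribʳ-++
      ; zeroˡ = λ f → pairingwise λ φ → refl
      }
    }
    where
      ≐-isEquivalence : IsEquivalence _≐_
      ≐-isEquivalence = record
        { refl  = pairingwise λ φ → refl
        ; sym   = λ f≐g → pairingwise λ φ → sym (pairing-≈ f≐g φ)
        ; trans = λ f≐g g≐h → pairingwise λ φ → trans (pairing-≈ f≐g φ) (pairing-≈ g≐h φ)
        }

  ★-cong : ∀ {f g} → f ≐ g → f ★ ≐ g ★
  ★-cong {f} {g} f≐g = pairingwise λ φ → begin
    ⟦ f ★ ⟧ φ                             ≈⟨ ⟦★⟧ f φ ⟩
    (⟦ f ⟧ (λ k → φ (ℤ.- k) ⋆)) ⋆         ≈⟨ ⋆-cong (pairing-≈ f≐g (λ k → φ (ℤ.- k) ⋆)) ⟩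
    (⟦ g ⟧ (λ k → φ (ℤ.- k) ⋆)) ⋆         ≈⟨ ⟦★⟧ g φ ⟨
    ⟦ g ★ ⟧ φ                             ∎

  ★-++ : ∀ f g → (f ++ g) ★ ≐ f ★ ++ g ★
  ★-++ f g = pairingwise λ φ → let φ⋆ = λ k → φ (ℤ.- k) ⋆ in begin
    ⟦ (f ++ g) ★ ⟧ φ                ≈⟨ ⟦★⟧ (f ++ g) φ ⟩
    (⟦ f ++ g ⟧ φ⋆) ⋆               ≈⟨ ⋆-cong (⟦++⟧ f g φ⋆) ⟩
    (⟦ f ⟧ φ⋆ + ⟦ g ⟧ φ⋆) ⋆         ≈⟨ ⋆-+ (⟦ f ⟧ φ⋆) (⟦ g ⟧ φ⋆) ⟩
    (⟦ f ⟧ φ⋆) ⋆ + (⟦ g ⟧ φ⋆) ⋆     ≈⟨ +-cong (⟦★⟧ f φ) (⟦★⟧ g φ) ⟨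
    ⟦ f ★ ⟧ φ + ⟦ g ★ ⟧ φ           ≈⟨ ⟦++⟧ (f ★) (g ★) φ ⟨
    ⟦ f ★ ++ g ★ ⟧ φ                ∎

  ★-⊛ : ∀ f g → (f ⊛ g) ★ ≐ f ★ ⊛ g ★
  ★-⊛ f g = pairingwise λ φ → begin
    ⟦ (f ⊛ g) ★ ⟧ φ
      ≈⟨ ⟦★⟧ (f ⊛ g) φ ⟩
    (⟦ f ⊛ g ⟧ (λ k → φ (ℤ.- k) ⋆)) ⋆
      ≈⟨ ⋆-cong (⟦⊛⟧ f g (λ k → φ (ℤ.- k) ⋆)) ⟩
    (⟦ f ⟧ (λ i → ⟦ g ⟧ (λ j → φ (ℤ.- (i ℤ.+ j)) ⋆))) ⋆
      ≈⟨ ⋆-cong (⟦⟧-cong f λ i → begin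
           ⟦ g ⟧ (λ j → φ (ℤ.- (i ℤ.+ j)) ⋆)
             ≈⟨ ⟦⟧-cong g (λ j → reflexive (≡.cong (λ k → φ k ⋆) (ℤ.neg-distrib-+ i j))) ⟩
           ⟦ g ⟧ (λ j → φ (ℤ.- i ℤ.+ ℤ.- j) ⋆)
             ≈⟨ ⋆-involutive _ ⟨
           (⟦ g ⟧ (λ j → φ (ℤ.- i ℤ.+ ℤ.- j) ⋆)) ⋆ ⋆
             ≈⟨ ⋆-cong (⟦★⟧ g (λ j → φ (ℤ.- i ℤ.+ j))) ⟨
           ⟦ g ★ ⟧ (λ j → φ (ℤ.- i ℤ.+ j)) ⋆ ∎) ⟩
    (⟦ f ⟧ (λ i → ⟦ g ★ ⟧ (λ j → φ (ℤ.- i ℤ.+ j)) ⋆)) ⋆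
      ≈⟨ ⟦★⟧ f (λ i → ⟦ g ★ ⟧ (λ j → φ (i ℤ.+ j))) ⟨
    ⟦ f ★ ⟧ (λ i → ⟦ g ★ ⟧ (λ j → φ (i ℤ.+ j)))
      ≈⟨ ⟦⊛⟧ (f ★) (g ★) φ ⟨
    ⟦ f ★ ⊛ g ★ ⟧ φ ∎

  ★-involutive : ∀ f → (f ★) ★ ≐ f
  ★-involutive f = pairingwise λ φ → begin
    ⟦ f ★ ★ ⟧ φ
      ≈⟨ ⟦★⟧ (f ★) φ ⟩
    (⟦ f ★ ⟧ (λ k → φ (ℤ.- k) ⋆)) ⋆
      ≈⟨ ⋆-cong (⟦★⟧ f (λ k → φ (ℤ.- k) ⋆)) ⟩
    (⟦ f ⟧ (λ k → φ (ℤ.- (ℤ.- k)) ⋆ ⋆)) ⋆ ⋆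
      ≈⟨ ⋆-involutive _ ⟩
    ⟦ f ⟧ (λ k → φ (ℤ.- (ℤ.- k)) ⋆ ⋆)
      ≈⟨ ⟦⟧-cong f (λ k → trans (⋆-involutive _) (reflexive (≡.cong φ (ℤ.neg-involutive k)))) ⟩
    ⟦ f ⟧ φ ∎

  laurentInvolution : Involution laurentSemiring
  laurentInvolution = record
    { _⋆ = _★
    ; ⋆-cong = ★-cong
    ; ⋆-+ = ★-++
    ; ⋆-* = ★-⊛
    ; ⋆-involutive = ★-involutive
    }

  z^-+ : ∀ k l → z^ (k ℤ.+ l) ≐ z^ k ⊛ z^ l
  z^-+ k l = pairingwise λ φ → +-congʳ (*-congʳ (sym (*-identityʳ 1#)))

  z^-★ : ∀ k → (z^ k) ★ ≐ z^ (ℤ.- k)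
  z^-★ k = pairingwise λ φ → +-congʳ (*-congʳ ⋆-1#)

  z^⊛z^-★ : ∀ k → z^ k ⊛ (z^ k) ★ ≐ z^ 0ℤ
  z^⊛z^-★ k = A.trans (A.*-congˡ {z^ k} (z^-★ k))
    (A.trans (A.sym (z^-+ k (ℤ.- k))) (A.reflexive (≡.cong z^_ (ℤ.+-inverseʳ k))))
    where module A = CommutativeSemiring laurentSemiring

  module LinearFunctional (F : Laurent → Carrier) (F-cong : ∀ {f g} → f ≐ g → F f ≈ F g)
    (F-++ : ∀ f g → F (f ++ g) ≈ F f + F g) (F-ι : ∀ a f → F (ι a ⊛ f) ≈ a * F f) where

    -- A linear functional is the pairing with its moments, since every single term is a scalar
    -- times a power of z.
    F≈⟦⟧ : ∀ f → F f ≈ ⟦ f ⟧ (λ k → F (z^ k))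
    F≈⟦⟧ [] = begin
      -- Additivity alone does not give the value zero here; `[]` is its own product with the zero
      -- scalar, and scaling does.
      F []                ≈⟨ F-cong (pairingwise λ φ → refl) ⟩
      F (ι 0# ⊛ [])       ≈⟨ F-ι 0# [] ⟩
      0# * F []           ≈⟨ zeroˡ (F []) ⟩
      0#                  ∎
    F≈⟦⟧ ((a , k) ∷ f) = begin
      F ((a , k) ∷ f)
        ≈⟨ F-++ ((a , k) ∷ []) f ⟩
      F ((a , k) ∷ []) + F f
        ≈⟨ +-cong (F-cong (pairingwise λ φ → trans (+-identityʳ (a * φ k)) (sym (trans
             (⟦ι⊛⟧ a (z^ k) φ) (*-congˡ (⟦z^⟧ k φ)))))) (F≈⟦⟧ f) ⟩
      F (ι a ⊛ z^ k) + ⟦ f ⟧ (λ k → F (z^ k))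
        ≈⟨ +-congʳ (F-ι a (z^ k)) ⟩
      a * F (z^ k) + ⟦ f ⟧ (λ k → F (z^ k)) ∎

    -- Nonnegative exponents suffice: applying `⋆` to the hypothesis gives the identity at the
    -- opposite exponents.
    F-★-from-monomials : (∀ n → F ((z^ (+ n)) ★) ≈ F (z^ (+ n)) ⋆) → ∀ f → F (f ★) ≈ F f ⋆
    F-★-from-monomials F[z★] f = begin
      F (f ★)                                   ≈⟨ F≈⟦⟧ (f ★) ⟩
      ⟦ f ★ ⟧ (λ k → F (z^ k))                  ≈⟨ ⟦★⟧ f (λ k → F (z^ k)) ⟩
      (⟦ f ⟧ (λ k → F (z^ (ℤ.- k)) ⋆)) ⋆        ≈⟨ ⋆-cong (⟦⟧-cong f F[z^-]) ⟩
      (⟦ f ⟧ (λ k → F (z^ k))) ⋆                ≈⟨ ⋆-cong (F≈⟦⟧ f) ⟨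
      F f ⋆                                     ∎
      where
        F[z^-n] : ∀ n → F (z^ (ℤ.- (+ n))) ≈ F (z^ (+ n)) ⋆
        F[z^-n] n = trans (sym (F-cong (z^-★ (+ n)))) (F[z★] n)
        F[z^-] : ∀ k → F (z^ (ℤ.- k)) ⋆ ≈ F (z^ k)
        F[z^-] (+ n)      = trans (⋆-cong (F[z^-n] n)) (⋆-involutive (F (z^ (+ n))))
        F[z^-] ℤ.-[1+ n ] = sym (F[z^-n] (suc n))

-- Polynomials presented as sums of monomials.

module SumsOfMonomials {c ℓ} (K : CommutativeRing c ℓ) where
  open CommutativeRing K hiding (zero)
  open SetoidReasoning setoid
  open SemiringSolver commutativeSemiring using (solve; _:+_; _:*_; _:=_)
  open RingProperties ring using (-‿distribˡ-*)

  private variable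
    X Y : Set

  evalMonomial : (X → Carrier) → List X → Carrier
  evalMonomial ρ = foldr (λ x a → ρ x * a) 1#

  -- Every listed monomial has coefficient 1 and repetitions act as multiplicities. Positivity is
  -- thus built into the format, which is closed under sums and products.
  evalSum : (X → Carrier) → List (List X) → Carrier
  evalSum ρ = foldr (λ m a → evalMonomial ρ m + a) 0#

  evalMonomial-++ : ∀ (ρ : X → Carrier) m m′ →
    evalMonomial ρ (m ++ m′) ≈ evalMonomial ρ m * evalMonomial ρ m′
  evalMonomial-++ ρ []      m′ = sym (*-identityˡ (evalMonomial ρ m′))
  evalMonomial-++ ρ (x ∷ m) m′ = trans (*-congˡ (evalMonomial-++ ρ m m′))
    (sym (*-assoc (ρ x) (evalMonomial ρ m) (evalMonomial ρ m′)))

  evalSum-++ : ∀ (ρ : X → Carrier) ms ms′ →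
    evalSum ρ (ms ++ ms′) ≈ evalSum ρ ms + evalSum ρ ms′
  evalSum-++ ρ []       ms′ = sym (+-identityˡ (evalSum ρ ms′))
  evalSum-++ ρ (m ∷ ms) ms′ = trans (+-congˡ (evalSum-++ ρ ms ms′))
    (sym (+-assoc (evalMonomial ρ m) (evalSum ρ ms) (evalSum ρ ms′)))

  evalSum-monomial* : ∀ (ρ : X → Carrier) m ms →
    evalSum ρ (map (m ++_) ms) ≈ evalMonomial ρ m * evalSum ρ ms
  evalSum-monomial* ρ m []        = sym (zeroʳ (evalMonomial ρ m))
  evalSum-monomial* ρ m (m′ ∷ ms) = trans
    (+-cong (evalMonomial-++ ρ m m′) (evalSum-monomial* ρ m ms))
    (sym (distribˡ (evalMonomial ρ m) (evalMonomial ρ m′) (evalSum ρ ms)))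

  evalSum-* : ∀ (ρ : X → Carrier) ms ms′ →
    evalSum ρ (cartesianProductWith _++_ ms ms′) ≈ evalSum ρ ms * evalSum ρ ms′
  evalSum-* ρ []       ms′ = sym (zeroˡ (evalSum ρ ms′))
  evalSum-* ρ (m ∷ ms) ms′ = begin
    evalSum ρ (map (m ++_) ms′ ++ cartesianProductWith _++_ ms ms′)
      ≈⟨ evalSum-++ ρ (map (m ++_) ms′) (cartesianProductWith _++_ ms ms′) ⟩
    evalSum ρ (map (m ++_) ms′) + evalSum ρ (cartesianProductWith _++_ ms ms′)
      ≈⟨ +-cong (evalSum-monomial* ρ m ms′) (evalSum-* ρ ms ms′) ⟩
    evalMonomial ρ m * evalSum ρ ms′ + evalSum ρ ms * evalSum ρ ms′
      ≈⟨ distribʳ (evalSum ρ ms′) (evalMonomial ρ m) (evalSum ρ ms) ⟨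
    (evalMonomial ρ m + evalSum ρ ms) * evalSum ρ ms′ ∎

  -- The list of monomials is chosen uniformly in i.
  IsSumOfMonomials : {I : Set} → (I → X → Carrier) → (I → Carrier) → Set ℓ
  IsSumOfMonomials ρ f = ∃[ ms ] (∀ i → f i ≈ evalSum (ρ i) ms)

  module _ {I : Set} {ρ : I → X → Carrier} where

    isSum-0# : IsSumOfMonomials ρ (λ _ → 0#)
    isSum-0# = [] , λ _ → refl

    isSum-1# : IsSumOfMonomials ρ (λ _ → 1#)
    isSum-1# = [] ∷ [] , λ _ → sym (+-identityʳ 1#)

    isSum-variable : ∀ x → IsSumOfMonomials ρ (λ i → ρ i x)
    isSum-variable x = (x ∷ []) ∷ [] , λ i →
      sym (trans (+-identityʳ (ρ i x * 1#)) (*-identityʳ (ρ i x)))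

    isSum-+ : ∀ {f g} → IsSumOfMonomials ρ f → IsSumOfMonomials ρ g →
      IsSumOfMonomials ρ (λ i → f i + g i)
    isSum-+ (ms , f≈) (ms′ , g≈) = ms ++ ms′ , λ i →
      trans (+-cong (f≈ i) (g≈ i)) (sym (evalSum-++ (ρ i) ms ms′))

    isSum-* : ∀ {f g} → IsSumOfMonomials ρ f → IsSumOfMonomials ρ g →
      IsSumOfMonomials ρ (λ i → f i * g i)
    isSum-* (ms , f≈) (ms′ , g≈) = cartesianProductWith _++_ ms ms′ , λ i →
      trans (*-cong (f≈ i) (g≈ i)) (sym (evalSum-* (ρ i) ms ms′))

    isSum-if : ∀ b → IsSumOfMonomials ρ (λ _ → if b then 1# else 0#)
    isSum-if true  = isSum-1#
    isSum-if false = isSum-0#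

  module IntegerCoefficients (fromℤ : ℤ → Carrier)
    (fromℤ-1 : fromℤ 1ℤ ≈ 1#) (fromℤ-neg : ∀ k → fromℤ (ℤ.- k) ≈ - fromℤ k) where

    eval : (X → Carrier) → List (ℤ × List X) → Carrier
    eval ρ = foldr (λ (k , m) a → fromℤ k * evalMonomial ρ m + a) 0#

    evalMonomial-rename : ∀ (h : X → Y) {ρ σ} → (∀ x → ρ x ≈ σ (h x)) →
      ∀ m → evalMonomial ρ m ≈ evalMonomial σ (map h m)
    evalMonomial-rename h ρ≈σ []      = refl
    evalMonomial-rename h ρ≈σ (x ∷ m) = *-cong (ρ≈σ x) (evalMonomial-rename h ρ≈σ m)

    evalSum-rename : ∀ (h : X → Y) {ρ σ} → (∀ x → ρ x ≈ σ (h x)) →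
      ∀ ms → evalSum ρ ms ≈ eval σ (map (λ m → 1ℤ , map h m) ms)
    evalSum-rename h ρ≈σ []       = refl
    evalSum-rename h {σ = σ} ρ≈σ (m ∷ ms) = +-cong
      (trans (evalMonomial-rename h ρ≈σ m)
        (sym (trans (*-congʳ fromℤ-1) (*-identityˡ (evalMonomial σ (map h m))))))
      (evalSum-rename h ρ≈σ ms)

    sign : List (X ⊎ Y) → ℤ
    sign []           = 1ℤ
    sign (inj₁ x ∷ m) = sign m
    sign (inj₂ y ∷ m) = ℤ.- sign m

    -- Each factor from the second family contributes one -1, so the total sign is the parity that
    -- `sign` counts. This turns monomials in α, β into integer terms in α and its conjugate.
    evalMonomial-sign : ∀ {ρ : X → Carrier} {σ τ : Y → Carrier} → (∀ y → τ y ≈ - σ y) →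
      ∀ m → evalMonomial [ ρ , τ ] m ≈ fromℤ (sign m) * evalMonomial [ ρ , σ ] m
    evalMonomial-sign τ≈-σ [] = sym (trans (*-congʳ fromℤ-1) (*-identityˡ 1#))
    evalMonomial-sign {ρ = ρ} {σ} τ≈-σ (inj₁ x ∷ m) =
      trans (*-congˡ (evalMonomial-sign τ≈-σ m))
        (solve 3 (λ x s e → x :* (s :* e) := s :* (x :* e)) refl
          (ρ x) (fromℤ (sign m)) (evalMonomial [ ρ , σ ] m))
    evalMonomial-sign {ρ = ρ} {σ} {τ} τ≈-σ (inj₂ y ∷ m) = begin
      τ y * evalMonomial [ ρ , τ ] m
        ≈⟨ *-cong (τ≈-σ y) (evalMonomial-sign τ≈-σ m) ⟩
      - σ y * (s * e)
        ≈⟨ -‿distribˡ-* (σ y) (s * e) ⟨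
      - (σ y * (s * e))
        ≈⟨ -‿cong (solve 3 (λ x s e → x :* (s :* e) := s :* (x :* e)) refl (σ y) s e) ⟩
      - (s * (σ y * e))
        ≈⟨ -‿distribˡ-* s (σ y * e) ⟩
      - s * (σ y * e)
        ≈⟨ *-congʳ (fromℤ-neg (sign m)) ⟨
      fromℤ (ℤ.- sign m) * (σ y * e) ∎
      where
        s e : Carrier
        s = fromℤ (sign m)
        e = evalMonomial [ ρ , σ ] m

    evalSum-sign : ∀ {ρ : X → Carrier} {σ τ : Y → Carrier} → (∀ y → τ y ≈ - σ y) →
      ∀ ms → evalSum [ ρ , τ ] ms ≈ eval [ ρ , σ ] (map (λ m → sign m , m) ms)
    evalSum-sign τ≈-σ []       = refl
    evalSum-sign τ≈-σ (m ∷ ms) = +-cong (evalMonomial-sign τ≈-σ m) (evalSum-sign τ≈-σ ms)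

-- The Szegő recursion over abstract rings with involution.

module Szegő {c ℓ c′ ℓ′}
  (K : CommutativeRing c ℓ) (conjugation : Involution (CommutativeRing.commutativeSemiring K))
  (A : CommutativeSemiring c′ ℓ′) (reflection : Involution A) where

  open CommutativeRing K hiding (zero)
  open Involution conjugation
  open SetoidReasoning setoid
  open SemiringSolver commutativeSemiring using (solve; _:+_; _:*_; _:=_; con)
  private
    module A where
      open CommutativeSemiring A public
      open SetoidReasoning (CommutativeSemiring.setoid A) public
      open SemiringSolver A public using (solve; _:+_; _:*_; _:=_)
  open Involution reflection using () renaming
    ( _⋆ to _★; ⋆-cong to ★-cong; ⋆-+ to ★-+; ⋆-* to ★-*
    ; ⋆-1# to ★-1#; ⋆-involutive to ★-involutive )

  ⋆-neg : ∀ x → (- x) ⋆ ≈ - x ⋆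
  ⋆-neg x = RingProperties.+-inverseʳ-unique ring (x ⋆) ((- x) ⋆)
    (trans (sym (⋆-+ x (- x))) (trans (⋆-cong (-‿inverseʳ x)) ⋆-0#))

  drop-unit-factor : ∀ {x} y u → x ≈ y * u → u ≈ 1# → x ≈ y
  drop-unit-factor y u x≈yu u≈1 = trans x≈yu (trans (*-congˡ u≈1) (*-identityʳ y))

  -- The recursion in a form without subtraction.
  record SzegőRecursion : Set (c ⊔ ℓ ⊔ c′ ⊔ ℓ′) where
    field
      ι      : Carrier → A.Carrier
      ι-★    : ∀ a → ι a ★ A.≈ ι (a ⋆)
      z      : ℕ → A.Carrier
      z-zero : z 0 A.≈ A.1#
      z-suc  : ∀ n → z (suc n) A.≈ z n A.* z 1
      -- Makes `z n ★` the inverse power z⁻ⁿ, although `z` itself is indexed by ℕ.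
      z-unit : ∀ n → z n A.* z n ★ A.≈ A.1#
      α      : ℕ → Carrier
      Φ      : ℕ → A.Carrier

    β : ℕ → Carrier
    β n = - α n ⋆

    Φ* : ℕ → A.Carrier
    Φ* n = z n A.* Φ n ★

    field
      Φ-zero : Φ 0 A.≈ A.1#
      Φ-suc  : ∀ n → Φ (suc n) A.≈ z 1 A.* Φ n A.+ ι (β n) A.* Φ* n

    β⋆+α : ∀ n → β n ⋆ + α n ≈ 0#
    β⋆+α n = begin
      (- α n ⋆) ⋆ + α n   ≈⟨ +-congʳ (⋆-neg (α n ⋆)) ⟩
      - α n ⋆ ⋆ + α n     ≈⟨ +-congʳ (-‿cong (⋆-involutive (α n))) ⟩
      - α n + α n         ≈⟨ -‿inverseˡ (α n) ⟩
      0#                  ∎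

    Φ*-zero : Φ* 0 A.≈ Φ 0
    Φ*-zero = A.begin
      z 0 A.* Φ 0 ★     A.≈⟨ A.*-cong z-zero (A.trans (★-cong Φ-zero) ★-1#) ⟩
      A.1# A.* A.1#     A.≈⟨ A.*-identityˡ A.1# ⟩
      A.1#              A.≈⟨ Φ-zero ⟨
      Φ 0               A.∎

    Φ*-★ : ∀ n → Φ* n ★ A.≈ z n ★ A.* Φ n
    Φ*-★ n = A.trans (★-* (z n) (Φ n ★)) (A.*-congˡ (★-involutive (Φ n)))

    Φ-suc-★ : ∀ n → Φ (suc n) ★ A.≈ z 1 ★ A.* Φ n ★ A.+ ι (β n ⋆) A.* (z n ★ A.* Φ n)
    Φ-suc-★ n = A.begin
      Φ (suc n) ★
        A.≈⟨ ★-cong (Φ-suc n) ⟩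
      (z 1 A.* Φ n A.+ ι (β n) A.* Φ* n) ★
        A.≈⟨ ★-+ (z 1 A.* Φ n) (ι (β n) A.* Φ* n) ⟩
      (z 1 A.* Φ n) ★ A.+ (ι (β n) A.* Φ* n) ★
        A.≈⟨ A.+-cong (★-* (z 1) (Φ n)) (★-* (ι (β n)) (Φ* n)) ⟩
      z 1 ★ A.* Φ n ★ A.+ ι (β n) ★ A.* Φ* n ★
        A.≈⟨ A.+-congˡ (A.*-cong (ι-★ (β n)) (Φ*-★ n)) ⟩
      z 1 ★ A.* Φ n ★ A.+ ι (β n ⋆) A.* (z n ★ A.* Φ n) A.∎

    -- The reversed recursion Φ*_{n+1} = Φ*_n - α_n zΦ_n: apply `★` to the recursion and multiply by
    -- z^{n+1}; each term then contains some `z k` times `z k ★`, which cancels.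
    Φ*-suc : ∀ n → Φ* (suc n) A.≈ Φ* n A.+ ι (β n ⋆) A.* (z 1 A.* Φ n)
    Φ*-suc n = A.begin
      z (suc n) A.* Φ (suc n) ★
        A.≈⟨ A.*-cong (z-suc n) (Φ-suc-★ n) ⟩
      (z n A.* z 1) A.* (z 1 ★ A.* Φ n ★ A.+ ι (β n ⋆) A.* (z n ★ A.* Φ n))
        A.≈⟨ A.solve 7 (λ zn z1 z1★ φ★ b zn★ φ →
               (zn A.:* z1) A.:* (z1★ A.:* φ★ A.:+ b A.:* (zn★ A.:* φ)) A.:=
               (z1 A.:* z1★) A.:* (zn A.:* φ★) A.:+ (zn A.:* zn★) A.:* (b A.:* (z1 A.:* φ)))
             A.refl (z n) (z 1) (z 1 ★) (Φ n ★) (ι (β n ⋆)) (z n ★) (Φ n) ⟩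
      (z 1 A.* z 1 ★) A.* Φ* n A.+ (z n A.* z n ★) A.* (ι (β n ⋆) A.* (z 1 A.* Φ n))
        A.≈⟨ A.+-cong (A.*-congʳ (z-unit 1)) (A.*-congʳ (z-unit n)) ⟩
      A.1# A.* Φ* n A.+ A.1# A.* (ι (β n ⋆) A.* (z 1 A.* Φ n))
        A.≈⟨ A.+-cong (A.*-identityˡ _) (A.*-identityˡ _) ⟩
      Φ* n A.+ ι (β n ⋆) A.* (z 1 A.* Φ n) A.∎

    -- Q n r s and Q* n r s are the conjugated coefficients of Φ s in the
    -- expansions of zⁿ Φ r and zⁿ Φ* r.
    Q Q* : ℕ → ℕ → ℕ → Carrier
    Q zero    r s = if does (r ℕ.≟ s) then 1# else 0#
    Q (suc n) r s = Q n (suc r) s + α r * Q* n r s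
    Q* n zero    s = Q n zero s
    -- The bracket is `Q (suc n) r s` written out, so that the first argument never grows in a
    -- recursive call.
    Q* n (suc r) s = Q* n r s + β r * (Q n (suc r) s + α r * Q* n r s)

    Q-zero-≡ : ∀ s → Q 0 s s ≈ 1#
    Q-zero-≡ s = reflexive (≡.cong (λ b → if b then 1# else 0#) (dec-true (s ℕ.≟ s) ≡.refl))

    Q-zero-≢ : ∀ {r s} → r ≢ s → Q 0 r s ≈ 0#
    Q-zero-≢ {r} {s} r≢s =
      reflexive (≡.cong (λ b → if b then 1# else 0#) (dec-false (r ℕ.≟ s) r≢s))

    -- Φ*_r has degree at most r, so its expansion in the Φ's stops at Φ_r.
    Q*-zero-< : ∀ {r s} → r ℕ.< s → Q* 0 r s ≈ 0#
    Q*-zero-< {zero}  {s} 0<s  = Q-zero-≢ (ℕ.<⇒≢ 0<s)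
    Q*-zero-< {suc r} {s} r+1<s = begin
      Q* 0 r s + β r * (Q 0 (suc r) s + α r * Q* 0 r s)
        ≈⟨ +-cong (Q*-zero-< (ℕ.<⇒≤ r+1<s))
             (*-congˡ (+-cong (Q-zero-≢ (ℕ.<⇒≢ r+1<s)) (*-congˡ (Q*-zero-< (ℕ.<⇒≤ r+1<s))))) ⟩
      0# + β r * (0# + α r * 0#)
        ≈⟨ solve 2 (λ a b → con 0 :+ b :* (con 0 :+ a :* con 0) := con 0) refl (α r) (β r) ⟩
      0# ∎

  -- Functionals that make the Φ's orthogonal.

  record OrthogonalityFunctional (recursion : SzegőRecursion) : Set (c ⊔ ℓ ⊔ c′ ⊔ ℓ′) where
    open SzegőRecursion recursion
    field
      F            : A.Carrier → Carrier
      F-cong       : ∀ {f g} → f A.≈ g → F f ≈ F g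
      F-+          : ∀ f g → F (f A.+ g) ≈ F f + F g
      F-ι          : ∀ a f → F (ι a A.* f) ≈ a * F f
      F-normalised : F A.1# ≈ 1#
      F-orthogonal : ∀ m n → m ≢ n → F (Φ m A.* Φ n ★) ≈ 0#

    ⟨_,_⟩ : A.Carrier → A.Carrier → Carrier
    ⟨ f , g ⟩ = F (f A.* g ★)

    ∥Φ∥² : ℕ → Carrier
    ∥Φ∥² s = ⟨ Φ s , Φ s ⟩

    ∥Φ∥²-zero : ∥Φ∥² 0 ≈ 1#
    ∥Φ∥²-zero = trans (F-cong (A.trans (A.*-cong Φ-zero (A.trans (★-cong Φ-zero) ★-1#))
      (A.*-identityˡ A.1#))) F-normalised

    ⟨⟩-congʳ : ∀ f {g h} → g A.≈ h → ⟨ f , g ⟩ ≈ ⟨ f , h ⟩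
    ⟨⟩-congʳ f g≈h = F-cong (A.*-congˡ (★-cong g≈h))

    ⟨⟩-linearˡ : ∀ f a g h → ⟨ f A.+ ι a A.* g , h ⟩ ≈ ⟨ f , h ⟩ + a * ⟨ g , h ⟩
    ⟨⟩-linearˡ f a g h = begin
      F ((f A.+ ι a A.* g) A.* h ★)
        ≈⟨ F-cong (A.trans (A.distribʳ (h ★) f (ι a A.* g)) (A.+-congˡ (A.*-assoc (ι a) g (h ★)))) ⟩
      F (f A.* h ★ A.+ ι a A.* (g A.* h ★))
        ≈⟨ F-+ (f A.* h ★) (ι a A.* (g A.* h ★)) ⟩
      F (f A.* h ★) + F (ι a A.* (g A.* h ★))
        ≈⟨ +-congˡ (F-ι a (g A.* h ★)) ⟩
      F (f A.* h ★) + a * F (g A.* h ★) ∎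

    ⟨⟩-antilinearʳ : ∀ f g a h → ⟨ f , g A.+ ι a A.* h ⟩ ≈ ⟨ f , g ⟩ + a ⋆ * ⟨ f , h ⟩
    ⟨⟩-antilinearʳ f g a h = begin
      F (f A.* (g A.+ ι a A.* h) ★)
        ≈⟨ F-cong (A.*-congˡ (A.trans (★-+ g (ι a A.* h))
             (A.+-congˡ (A.trans (★-* (ι a) h) (A.*-congʳ (ι-★ a)))))) ⟩
      F (f A.* (g ★ A.+ ι (a ⋆) A.* h ★))
        ≈⟨ F-cong (A.solve 4 (λ f g a h →
             f A.:* (g A.:+ a A.:* h) A.:= f A.:* g A.:+ a A.:* (f A.:* h))
             A.refl f (g ★) (ι (a ⋆)) (h ★)) ⟩
      F (f A.* g ★ A.+ ι (a ⋆) A.* (f A.* h ★))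
        ≈⟨ trans (F-+ (f A.* g ★) (ι (a ⋆) A.* (f A.* h ★))) (+-congˡ (F-ι (a ⋆) (f A.* h ★))) ⟩
      F (f A.* g ★) + a ⋆ * F (f A.* h ★) ∎

    -- In effect h = g + conj(α_r) k, whose scalar becomes α_r in the antilinear argument. As `A`
    -- has no subtraction, g is expanded instead and the extra term is cancelled in `K` by `β⋆+α`.
    ⟨⟩-subtract : ∀ f r {g h k} → g A.≈ h A.+ ι (β r) A.* k →
      ⟨ f , h ⟩ ≈ ⟨ f , g ⟩ + α r * ⟨ f , k ⟩
    ⟨⟩-subtract f r {g} {h} {k} g≈h+βk = sym (begin
      ⟨ f , g ⟩ + α r * ⟨ f , k ⟩
        ≈⟨ +-congʳ (trans (⟨⟩-congʳ f g≈h+βk) (⟨⟩-antilinearʳ f h (β r) k)) ⟩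
      ⟨ f , h ⟩ + β r ⋆ * ⟨ f , k ⟩ + α r * ⟨ f , k ⟩
        ≈⟨ solve 4 (λ h b a k → h :+ b :* k :+ a :* k := h :+ (b :+ a) :* k)
             refl ⟨ f , h ⟩ (β r ⋆) (α r) ⟨ f , k ⟩ ⟩
      ⟨ f , h ⟩ + (β r ⋆ + α r) * ⟨ f , k ⟩
        ≈⟨ +-congˡ (trans (*-congʳ (β⋆+α r)) (zeroˡ ⟨ f , k ⟩)) ⟩
      ⟨ f , h ⟩ + 0#
        ≈⟨ +-identityʳ ⟨ f , h ⟩ ⟩
      ⟨ f , h ⟩ ∎)

    M M* : ℕ → ℕ → ℕ → Carrier
    M  n r s = ⟨ Φ s , z n A.* Φ r ⟩
    M* n r s = ⟨ Φ s , z n A.* Φ* r ⟩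

    M-suc : ∀ n r s → M (suc n) r s ≈ M n (suc r) s + α r * M* n r s
    M-suc n r s = ⟨⟩-subtract (Φ s) r z^nΦ-suc
      where
        z^nΦ-suc : z n A.* Φ (suc r) A.≈ z (suc n) A.* Φ r A.+ ι (β r) A.* (z n A.* Φ* r)
        z^nΦ-suc = A.begin
          z n A.* Φ (suc r)
            A.≈⟨ A.*-congˡ (Φ-suc r) ⟩
          z n A.* (z 1 A.* Φ r A.+ ι (β r) A.* Φ* r)
            A.≈⟨ A.solve 5 (λ zn z1 φ b φ* → zn A.:* (z1 A.:* φ A.:+ b A.:* φ*) A.:=
                   (zn A.:* z1) A.:* φ A.:+ b A.:* (zn A.:* φ*))
                 A.refl (z n) (z 1) (Φ r) (ι (β r)) (Φ* r) ⟩
          (z n A.* z 1) A.* Φ r A.+ ι (β r) A.* (z n A.* Φ* r)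
            A.≈⟨ A.+-congʳ (A.*-congʳ (z-suc n)) ⟨
          z (suc n) A.* Φ r A.+ ι (β r) A.* (z n A.* Φ* r) A.∎

    M*-zero : ∀ n s → M* n 0 s ≈ M n 0 s
    M*-zero n s = ⟨⟩-congʳ (Φ s) (A.*-congˡ Φ*-zero)

    M*-suc : ∀ n r s → M* n (suc r) s ≈ M* n r s + β r * M (suc n) r s
    M*-suc n r s = begin
      M* n (suc r) s
        ≈⟨ ⟨⟩-congʳ (Φ s) z^nΦ*-suc ⟩
      ⟨ Φ s , z n A.* Φ* r A.+ ι (β r ⋆) A.* (z (suc n) A.* Φ r) ⟩
        ≈⟨ ⟨⟩-antilinearʳ (Φ s) (z n A.* Φ* r) (β r ⋆) (z (suc n) A.* Φ r) ⟩
      M* n r s + β r ⋆ ⋆ * M (suc n) r s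
        ≈⟨ +-congˡ (*-congʳ (⋆-involutive (β r))) ⟩
      M* n r s + β r * M (suc n) r s ∎
      where
        z^nΦ*-suc : z n A.* Φ* (suc r) A.≈ z n A.* Φ* r A.+ ι (β r ⋆) A.* (z (suc n) A.* Φ r)
        z^nΦ*-suc = A.begin
          z n A.* Φ* (suc r)
            A.≈⟨ A.*-congˡ (Φ*-suc r) ⟩
          z n A.* (Φ* r A.+ ι (β r ⋆) A.* (z 1 A.* Φ r))
            A.≈⟨ A.solve 5 (λ zn z1 φ b φ* → zn A.:* (φ* A.:+ b A.:* (z1 A.:* φ)) A.:=
                   zn A.:* φ* A.:+ b A.:* ((zn A.:* z1) A.:* φ))
                 A.refl (z n) (z 1) (Φ r) (ι (β r ⋆)) (Φ* r) ⟩
          z n A.* Φ* r A.+ ι (β r ⋆) A.* ((z n A.* z 1) A.* Φ r)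
            A.≈⟨ A.+-congˡ (A.*-congˡ (A.*-congʳ (z-suc n))) ⟨
          z n A.* Φ* r A.+ ι (β r ⋆) A.* (z (suc n) A.* Φ r) A.∎

    -- Stated with the norm as a factor rather than divided by it: the vanishing of ⟨Φ_{s+1} ,
    -- Φ*_s⟩, and with it the formula for the norms, is derived from `M*≈Q*` before any norm is
    -- known to be invertible.
    M≈Q : ∀ n r s → M n r s ≈ Q n r s * ∥Φ∥² s
    M*≈Q* : ∀ n r s → M* n r s ≈ Q* n r s * ∥Φ∥² s
    M≈Q zero r s = trans (⟨⟩-congʳ (Φ s) (A.trans (A.*-congʳ z-zero) (A.*-identityˡ (Φ r)))) ⟨Φ,Φ⟩
      where
        ⟨Φ,Φ⟩ : ⟨ Φ s , Φ r ⟩ ≈ Q 0 r s * ∥Φ∥² s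
        ⟨Φ,Φ⟩ with r ℕ.≟ s
        ... | yes ≡.refl = sym (trans (*-congʳ (Q-zero-≡ s)) (*-identityˡ (∥Φ∥² s)))
        ... | no  r≢s    = trans (F-orthogonal s r (r≢s ∘ ≡.sym))
                             (sym (trans (*-congʳ (Q-zero-≢ r≢s)) (zeroˡ (∥Φ∥² s))))
    M≈Q (suc n) r s = begin
      M (suc n) r s
        ≈⟨ M-suc n r s ⟩
      M n (suc r) s + α r * M* n r s
        ≈⟨ +-cong (M≈Q n (suc r) s) (*-congˡ (M*≈Q* n r s)) ⟩
      Q n (suc r) s * ∥Φ∥² s + α r * (Q* n r s * ∥Φ∥² s)
        ≈⟨ solve 4 (λ q a q* N → q :* N :+ a :* (q* :* N) := (q :+ a :* q*) :* N)
             refl (Q n (suc r) s) (α r) (Q* n r s) (∥Φ∥² s) ⟩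
      Q (suc n) r s * ∥Φ∥² s ∎
    M*≈Q* n zero    s = trans (M*-zero n s) (M≈Q n zero s)
    M*≈Q* n (suc r) s = begin
      M* n (suc r) s
        ≈⟨ M*-suc n r s ⟩
      M* n r s + β r * M (suc n) r s
        ≈⟨ +-congˡ (*-congˡ (M-suc n r s)) ⟩
      M* n r s + β r * (M n (suc r) s + α r * M* n r s)
        ≈⟨ +-cong (M*≈Q* n r s)
             (*-congˡ (+-cong (M≈Q n (suc r) s) (*-congˡ (M*≈Q* n r s)))) ⟩
      Q* n r s * ∥Φ∥² s + β r * (Q n (suc r) s * ∥Φ∥² s + α r * (Q* n r s * ∥Φ∥² s))
        ≈⟨ solve 5 (λ q a b q* N → q* :* N :+ b :* (q :* N :+ a :* (q* :* N)) :=
             (q* :+ b :* (q :+ a :* q*)) :* N)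
             refl (Q n (suc r) s) (α r) (β r) (Q* n r s) (∥Φ∥² s) ⟩
      Q* n (suc r) s * ∥Φ∥² s ∎

    M/∥Φ∥²≈Q : ∀ n r s u → ∥Φ∥² s * u ≈ 1# → M n r s * u ≈ Q n r s
    M/∥Φ∥²≈Q n r s u Nu≈1 = begin
      M n r s * u                 ≈⟨ *-congʳ (M≈Q n r s) ⟩
      Q n r s * ∥Φ∥² s * u        ≈⟨ *-assoc (Q n r s) (∥Φ∥² s) u ⟩
      Q n r s * (∥Φ∥² s * u)      ≈⟨ *-congˡ Nu≈1 ⟩
      Q n r s * 1#                ≈⟨ *-identityʳ (Q n r s) ⟩
      Q n r s                     ∎

    -- `Q` depends on the recursion only, so any two functionals for the same recursion have these
    -- moments in common.
    F[z★]≈Q : ∀ n → F (z n ★) ≈ Q n 0 0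
    F[z★]≈Q n = begin
      F (z n ★)               ≈⟨ F-cong (A.sym (A.begin
        Φ 0 A.* (z n A.* Φ 0) ★     A.≈⟨ A.*-cong Φ-zero (★-cong (A.trans (A.*-congˡ Φ-zero) (A.*-identityʳ (z n)))) ⟩
        A.1# A.* z n ★              A.≈⟨ A.*-identityˡ (z n ★) ⟩
        z n ★                       A.∎)) ⟩
      M n 0 0                 ≈⟨ M≈Q n 0 0 ⟩
      Q n 0 0 * ∥Φ∥² 0        ≈⟨ *-congˡ ∥Φ∥²-zero ⟩
      Q n 0 0 * 1#            ≈⟨ *-identityʳ (Q n 0 0) ⟩
      Q n 0 0                 ∎

    -- The two conjugations make the functional linear again. Its orthogonality at (m , n) is that
    -- of `F` at (n , m), available because orthogonality is assumed for both orders.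
    reflected : OrthogonalityFunctional recursion
    reflected = record
      { F            = λ f → F (f ★) ⋆
      ; F-cong       = λ f≈g → ⋆-cong (F-cong (★-cong f≈g))
      ; F-+          = λ f g → trans (⋆-cong (trans (F-cong (★-+ f g)) (F-+ (f ★) (g ★))))
                         (⋆-+ (F (f ★)) (F (g ★)))
      ; F-ι          = λ a f → begin
          F ((ι a A.* f) ★) ⋆         ≈⟨ ⋆-cong (F-cong (A.trans (★-* (ι a) f) (A.*-congʳ (ι-★ a)))) ⟩
          F (ι (a ⋆) A.* f ★) ⋆       ≈⟨ ⋆-cong (F-ι (a ⋆) (f ★)) ⟩
          (a ⋆ * F (f ★)) ⋆           ≈⟨ ⋆-* (a ⋆) (F (f ★)) ⟩
          a ⋆ ⋆ * F (f ★) ⋆           ≈⟨ *-congʳ (⋆-involutive a) ⟩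
          a * F (f ★) ⋆               ∎
      ; F-normalised = trans (⋆-cong (trans (F-cong ★-1#) F-normalised)) ⋆-1#
      ; F-orthogonal = λ m n m≢n → begin
          F ((Φ m A.* Φ n ★) ★) ⋆
            ≈⟨ ⋆-cong (F-cong (A.trans (★-* (Φ m) (Φ n ★)) (A.*-comm (Φ m ★) (Φ n ★ ★)))) ⟩
          F (Φ n ★ ★ A.* Φ m ★) ⋆
            ≈⟨ ⋆-cong (F-cong (A.*-congʳ (★-involutive (Φ n)))) ⟩
          F (Φ n A.* Φ m ★) ⋆
            ≈⟨ ⋆-cong (F-orthogonal n m (m≢n ∘ ≡.sym)) ⟩
          0# ⋆
            ≈⟨ ⋆-0# ⟩
          0# ∎
      }

  -- The coefficients as sums of monomials, uniformly in the system.

  module _ {I : Set} (recursion : I → SzegőRecursion) (N : ℕ) where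
    open SzegőRecursion
    open SumsOfMonomials K

    variables : I → Fin N ⊎ Fin N → Carrier
    variables i = [ α (recursion i) ∘ toℕ , β (recursion i) ∘ toℕ ]

    isSum-α : ∀ {r} → r ℕ.< N → IsSumOfMonomials variables (λ i → α (recursion i) r)
    isSum-α r<N = ≡.subst (λ r → IsSumOfMonomials variables (λ i → α (recursion i) r))
      (Fin.toℕ-fromℕ< r<N) (isSum-variable (inj₁ (fromℕ< r<N)))

    isSum-β : ∀ {r} → r ℕ.< N → IsSumOfMonomials variables (λ i → β (recursion i) r)
    isSum-β r<N = ≡.subst (λ r → IsSumOfMonomials variables (λ i → β (recursion i) r))
      (Fin.toℕ-fromℕ< r<N) (isSum-variable (inj₂ (fromℕ< r<N)))

    -- The sum n + r never increases along the recursion, and `α r`, `β r` enter only where r lies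
    -- below it. This confines the variables to indices below the initial n + r.
    isSum-Q : ∀ n r s → n +ℕ r ℕ.≤ N → IsSumOfMonomials variables (λ i → Q (recursion i) n r s)
    isSum-Q* : ∀ n r s → n +ℕ r ℕ.≤ N → IsSumOfMonomials variables (λ i → Q* (recursion i) n r s)
    isSum-Q zero    r s _ = isSum-if (does (r ℕ.≟ s))
    isSum-Q (suc n) r s n+r<N = isSum-+
      (isSum-Q n (suc r) s (≡.subst (ℕ._≤ N) (≡.sym (ℕ.+-suc n r)) n+r<N))
      (isSum-* (isSum-α (ℕ.≤-<-trans (ℕ.m≤n+m r n) n+r<N)) (isSum-Q* n r s (ℕ.<⇒≤ n+r<N)))
    isSum-Q* n zero    s n≤N = isSum-Q n zero s n≤N
    isSum-Q* n (suc r) s n+r<N = isSum-+ Q*-r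
      (isSum-* (isSum-β r<N) (isSum-+ (isSum-Q n (suc r) s n+r<N) (isSum-* (isSum-α r<N) Q*-r)))
      where
        r<N : r ℕ.< N
        -- `n+r<N` has the type `n + suc r ≤ N`; dropping n leaves `suc r ≤ N`, that is `r < N`.
        r<N = ℕ.m+n≤o⇒n≤o n n+r<N
        Q*-r : IsSumOfMonomials variables (λ i → Q* (recursion i) n r s)
        Q*-r = isSum-Q* n r s (ℕ.≤-trans (ℕ.+-monoʳ-≤ n (ℕ.n≤1+n r)) n+r<N)

  -- Hermitian symmetry, norms and reciprocity.

  module _ {recursion : SzegőRecursion} (functional : OrthogonalityFunctional recursion) where
    open SzegőRecursion recursion
    open OrthogonalityFunctional functional

    -- Both F and its reflection take the value Q n 0 0 at z⁻ⁿ.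
    F[z★]≈F[z]⋆ : ∀ n → F (z n ★) ≈ F (z n) ⋆
    F[z★]≈F[z]⋆ n = begin
      F (z n ★)         ≈⟨ F[z★]≈Q n ⟩
      Q n 0 0           ≈⟨ OrthogonalityFunctional.F[z★]≈Q reflected n ⟨
      F (z n ★ ★) ⋆     ≈⟨ ⋆-cong (F-cong (★-involutive (z n))) ⟩
      F (z n) ⋆         ∎

    -- The abstract `A` is not known to be spanned by powers of z, so the passage from powers to all
    -- f is a parameter, to be supplied for Laurent polynomials.
    module Hermitian (F-★ : ∀ f → F (f ★) ≈ F f ⋆) where

      ⟨⟩-hermitian : ∀ f g → ⟨ g , f ⟩ ≈ ⟨ f , g ⟩ ⋆
      ⟨⟩-hermitian f g = begin
        F (g A.* f ★)         ≈⟨ F-cong (A.trans (A.*-comm g (f ★)) (A.*-congˡ (A.sym (★-involutive g)))) ⟩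
        F (f ★ A.* g ★ ★)     ≈⟨ F-cong (★-* f (g ★)) ⟨
        F ((f A.* g ★) ★)     ≈⟨ F-★ (f A.* g ★) ⟩
        F (f A.* g ★) ⋆       ∎

      ∥Φ∥²-⋆ : ∀ s → ∥Φ∥² s ⋆ ≈ ∥Φ∥² s
      ∥Φ∥²-⋆ s = sym (⟨⟩-hermitian (Φ s) (Φ s))

      -- Multiplication by zⁿ is unitary because `★` inverts z, as conjugation does on the unit
      -- circle.
      ⟨z,z⟩ : ∀ n f g → ⟨ z n A.* f , z n A.* g ⟩ ≈ ⟨ f , g ⟩
      ⟨z,z⟩ n f g = F-cong (A.begin
        (z n A.* f) A.* (z n A.* g) ★
          A.≈⟨ A.*-congˡ (★-* (z n) g) ⟩
        (z n A.* f) A.* (z n ★ A.* g ★)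
          A.≈⟨ A.solve 4 (λ z f z★ g → (z A.:* f) A.:* (z★ A.:* g) A.:= (z A.:* z★) A.:* (f A.:* g))
                 A.refl (z n) f (z n ★) (g ★) ⟩
        (z n A.* z n ★) A.* (f A.* g ★)
          A.≈⟨ A.trans (A.*-congʳ (z-unit n)) (A.*-identityˡ (f A.* g ★)) ⟩
        f A.* g ★ A.∎)

      ∥Φ*∥² : ∀ s → ⟨ Φ* s , Φ* s ⟩ ≈ ∥Φ∥² s
      ∥Φ*∥² s = begin
        ⟨ z s A.* Φ s ★ , z s A.* Φ s ★ ⟩   ≈⟨ ⟨z,z⟩ s (Φ s ★) (Φ s ★) ⟩
        F (Φ s ★ A.* Φ s ★ ★)               ≈⟨ F-cong (A.trans (A.*-congˡ (★-involutive (Φ s))) (A.*-comm (Φ s ★) (Φ s))) ⟩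
        F (Φ s A.* Φ s ★)                   ∎

      -- Φ*_s has degree at most s, hence lies in the span of Φ_0, ..., Φ_s.
      ⟨Φ,Φ*⟩ : ∀ s → ⟨ Φ (suc s) , Φ* s ⟩ ≈ 0#
      ⟨Φ,Φ*⟩ s = begin
        ⟨ Φ (suc s) , Φ* s ⟩              ≈⟨ ⟨⟩-congʳ (Φ (suc s)) (A.trans (A.*-congʳ z-zero) (A.*-identityˡ (Φ* s))) ⟨
        M* 0 s (suc s)                    ≈⟨ M*≈Q* 0 s (suc s) ⟩
        Q* 0 s (suc s) * ∥Φ∥² (suc s)     ≈⟨ *-congʳ (Q*-zero-< (ℕ.n<1+n s)) ⟩
        0# * ∥Φ∥² (suc s)                 ≈⟨ zeroˡ (∥Φ∥² (suc s)) ⟩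
        0#                                ∎

      ⟨Φ*,Φ⟩ : ∀ s → ⟨ Φ* s , Φ (suc s) ⟩ ≈ 0#
      ⟨Φ*,Φ⟩ s = trans (⟨⟩-hermitian (Φ (suc s)) (Φ* s)) (trans (⋆-cong (⟨Φ,Φ*⟩ s)) ⋆-0#)

      ⟨f,zΦ⟩ : ∀ f s → ⟨ f , z 1 A.* Φ s ⟩ ≈ ⟨ f , Φ (suc s) ⟩ + α s * ⟨ f , Φ* s ⟩
      ⟨f,zΦ⟩ f s = ⟨⟩-subtract f s (Φ-suc s)

      ∥Φ∥²-suc : ∀ s → ∥Φ∥² (suc s) ≈ ∥Φ∥² s * (1# + β s * α s)
      ∥Φ∥²-suc s = begin
        ⟨ Φ (suc s) , Φ (suc s) ⟩
          -- A vanishing term is added so that the second argument becomes zΦ_s. Expanding the first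
          -- argument then leaves two terms, both multiples of ⟨Φ_s , Φ_s⟩.
          ≈⟨ trans (+-congˡ (trans (*-congˡ (⟨Φ,Φ*⟩ s)) (zeroʳ (α s)))) (+-identityʳ _) ⟨
        ⟨ Φ (suc s) , Φ (suc s) ⟩ + α s * ⟨ Φ (suc s) , Φ* s ⟩
          ≈⟨ ⟨f,zΦ⟩ (Φ (suc s)) s ⟨
        ⟨ Φ (suc s) , z 1 A.* Φ s ⟩
          ≈⟨ F-cong (A.*-congʳ (Φ-suc s)) ⟩
        ⟨ z 1 A.* Φ s A.+ ι (β s) A.* Φ* s , z 1 A.* Φ s ⟩
          ≈⟨ ⟨⟩-linearˡ (z 1 A.* Φ s) (β s) (Φ* s) (z 1 A.* Φ s) ⟩
        ⟨ z 1 A.* Φ s , z 1 A.* Φ s ⟩ + β s * ⟨ Φ* s , z 1 A.* Φ s ⟩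
          ≈⟨ +-cong (⟨z,z⟩ 1 (Φ s) (Φ s)) (*-congˡ (begin
               ⟨ Φ* s , z 1 A.* Φ s ⟩
                 ≈⟨ ⟨f,zΦ⟩ (Φ* s) s ⟩
               ⟨ Φ* s , Φ (suc s) ⟩ + α s * ⟨ Φ* s , Φ* s ⟩
                 ≈⟨ +-cong (⟨Φ*,Φ⟩ s) (*-congˡ (∥Φ*∥² s)) ⟩
               0# + α s * ∥Φ∥² s
                 ≈⟨ +-identityˡ (α s * ∥Φ∥² s) ⟩
               α s * ∥Φ∥² s ∎)) ⟩
        ∥Φ∥² s + β s * (α s * ∥Φ∥² s)
          ≈⟨ solve 3 (λ a b N → N :+ b :* (a :* N) := N :* (con 1 :+ b :* a)) refl (α s) (β s) (∥Φ∥² s) ⟩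
        ∥Φ∥² s * (1# + β s * α s) ∎

      M-reciprocal : ∀ n r s → ⟨ Φ s , z n ★ A.* Φ r ⟩ ≈ M n s r ⋆
      M-reciprocal n r s = begin
        ⟨ Φ s , z n ★ A.* Φ r ⟩                 ≈⟨ ⟨z,z⟩ n (Φ s) (z n ★ A.* Φ r) ⟨
        ⟨ z n A.* Φ s , z n A.* (z n ★ A.* Φ r) ⟩ ≈⟨ ⟨⟩-congʳ (z n A.* Φ s) (A.begin
          z n A.* (z n ★ A.* Φ r)     A.≈⟨ A.*-assoc (z n) (z n ★) (Φ r) ⟨
          (z n A.* z n ★) A.* Φ r     A.≈⟨ A.*-congʳ (z-unit n) ⟩
          A.1# A.* Φ r                A.≈⟨ A.*-identityˡ (Φ r) ⟩
          Φ r                         A.∎) ⟩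
        ⟨ z n A.* Φ s , Φ r ⟩                   ≈⟨ ⟨⟩-hermitian (Φ r) (z n A.* Φ s) ⟩
        M n s r ⋆                               ∎

      -- Every division in the theorem carries its own inverse, so `u`, `v`, `q⁻¹` are arbitrary:
      -- uniqueness of inverses identifies `q⁻¹` with `v`, and since norms are self-conjugate `u ⋆`
      -- is inverse to `p`. `z⁻ⁿ` is separate from `z n ★` because the two are equal only up to `≈`
      -- in `A`.
      reciprocity : ∀ n r s z⁻ⁿ u v p q q⁻¹ → z⁻ⁿ A.≈ z n ★ →
        u * ∥Φ∥² r ≈ 1# → v * ∥Φ∥² s ≈ 1# → ∥Φ∥² r ≈ p → ∥Φ∥² s ≈ q → q * q⁻¹ ≈ 1# →
        ⟨ Φ s , z⁻ⁿ A.* Φ r ⟩ * v ≈ (M n s r * u) ⋆ * (p * q⁻¹)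
      reciprocity n r s z⁻ⁿ u v p q q⁻¹ z⁻ⁿ≈z★ uNr≈1 vNs≈1 Nr≈p Ns≈q qq⁻¹≈1 = sym (begin
        (M n s r * u) ⋆ * (p * q⁻¹)
          ≈⟨ *-congʳ (⋆-* (M n s r) u) ⟩
        M n s r ⋆ * u ⋆ * (p * q⁻¹)
          ≈⟨ solve 4 (λ m u p q → m :* u :* (p :* q) := m :* ((u :* p) :* q))
               refl (M n s r ⋆) (u ⋆) p q⁻¹ ⟩
        M n s r ⋆ * ((u ⋆ * p) * q⁻¹)
          ≈⟨ *-cong (sym (M-reciprocal n r s)) (*-cong u⋆p≈1 q⁻¹≈v) ⟩
        ⟨ Φ s , z n ★ A.* Φ r ⟩ * (1# * v)
          ≈⟨ *-cong (⟨⟩-congʳ (Φ s) (A.*-congʳ (A.sym z⁻ⁿ≈z★))) (*-identityˡ v) ⟩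
        ⟨ Φ s , z⁻ⁿ A.* Φ r ⟩ * v ∎)
        where
          u⋆p≈1 : u ⋆ * p ≈ 1#
          u⋆p≈1 = begin
            u ⋆ * p             ≈⟨ *-congˡ (trans (∥Φ∥²-⋆ r) Nr≈p) ⟨
            u ⋆ * ∥Φ∥² r ⋆      ≈⟨ ⋆-* u (∥Φ∥² r) ⟨
            (u * ∥Φ∥² r) ⋆      ≈⟨ ⋆-cong uNr≈1 ⟩
            1# ⋆                ≈⟨ ⋆-1# ⟩
            1#                  ∎
          q⁻¹≈v : q⁻¹ ≈ v
          q⁻¹≈v = begin
            q⁻¹                 ≈⟨ *-identityˡ q⁻¹ ⟨
            1# * q⁻¹            ≈⟨ *-congʳ vNs≈1 ⟨
            v * ∥Φ∥² s * q⁻¹    ≈⟨ *-assoc v (∥Φ∥² s) q⁻¹ ⟩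
            v * (∥Φ∥² s * q⁻¹)  ≈⟨ *-congˡ (trans (*-congʳ Ns≈q) qq⁻¹≈1) ⟩
            v * 1#              ≈⟨ *-identityʳ v ⟩
            v                   ∎

open import Defs

-- Arithmetic of Cauchy reals.

module RealNumbers where
  open Rational
  open CauchyClosure using (bounded; *-estimate)
  open Root using (0≤root; root²≤; ≤[root+width]²; width≡; 0≤width)
  open +-*-Solver
  open ℚ.≤-Reasoning

  p≡q⇒∣p-q∣≤ : ∀ {p q ε} → p ≡ q → 0ℚ ℚ.< ε → ℚ.∣ p ℚ.- q ∣ ℚ.≤ ε
  p≡q⇒∣p-q∣≤ {p} {q} {ε} p≡q 0<ε = begin
    ℚ.∣ p ℚ.- q ∣   ≡⟨ ≡.cong (λ t → ℚ.∣ t ℚ.- q ∣) p≡q ⟩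
    ℚ.∣ q ℚ.- q ∣   ≡⟨ ≡.cong ℚ.∣_∣ (ℚ.+-inverseʳ q) ⟩
    0ℚ              ≤⟨ ℚ.<⇒≤ 0<ε ⟩
    ε               ∎

  -- Operations are termwise, so each ring law reduces to an identity in ℚ.
  pointwise : ∀ {x y} → (∀ n → seq x n ≡ seq y n) → x ≈ℝ y
  pointwise x≡y = eventually λ ε 0<ε → 0 , λ n _ → p≡q⇒∣p-q∣≤ (x≡y n) 0<ε

  ≈ℝ-refl : ∀ {x} → x ≈ℝ x
  ≈ℝ-refl = pointwise λ _ → ≡.refl

  ≈ℝ-sym : ∀ {x y} → x ≈ℝ y → y ≈ℝ x
  ≈ℝ-sym {x} {y} x≈y = eventually λ ε 0<ε → let N , h = close x≈y ε 0<ε in N , λ n N≤n → begin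
    ℚ.∣ seq y n ℚ.- seq x n ∣         ≡⟨ ≡.cong ℚ.∣_∣ (solve 2 (λ a b → b :- a := :- (a :- b))
                                          ≡.refl (seq x n) (seq y n)) ⟩
    ℚ.∣ ℚ.- (seq x n ℚ.- seq y n) ∣   ≡⟨ ℚ.∣-p∣≡∣p∣ (seq x n ℚ.- seq y n) ⟩
    ℚ.∣ seq x n ℚ.- seq y n ∣         ≤⟨ h n N≤n ⟩
    ε                                 ∎

  -ℝ-cong : ∀ {x y} → x ≈ℝ y → -ℝ x ≈ℝ -ℝ y
  -ℝ-cong {x} {y} x≈y = eventually λ ε 0<ε → let N , h = close (≈ℝ-sym x≈y) ε 0<ε in N , λ n N≤n → begin
    ℚ.∣ ℚ.- seq x n ℚ.- ℚ.- seq y n ∣   ≡⟨ ≡.cong ℚ.∣_∣ (solve 2 (λ a b → :- a :- :- b := b :- a)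
                                            ≡.refl (seq x n) (seq y n)) ⟩
    ℚ.∣ seq y n ℚ.- seq x n ∣           ≤⟨ h n N≤n ⟩
    ε                                   ∎

  +ℝ-cong : ∀ {x x′ y y′} → x ≈ℝ x′ → y ≈ℝ y′ → x +ℝ y ≈ℝ x′ +ℝ y′
  +ℝ-cong {x} {x′} {y} {y′} x≈x′ y≈y′ = eventually λ ε 0<ε →
    let M , hx = close x≈x′ (ε ℚ.* ½) (half-pos 0<ε)
        N , hy = close y≈y′ (ε ℚ.* ½) (half-pos 0<ε)
    in M ℕ.⊔ N , λ n M⊔N≤n → begin
      ℚ.∣ (seq x n ℚ.+ seq y n) ℚ.- (seq x′ n ℚ.+ seq y′ n) ∣
        ≡⟨ ≡.cong ℚ.∣_∣ (solve 4 (λ a b c d → (a :+ b) :- (c :+ d) := (a :- c) :+ (b :- d))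
             ≡.refl (seq x n) (seq y n) (seq x′ n) (seq y′ n)) ⟩
      ℚ.∣ (seq x n ℚ.- seq x′ n) ℚ.+ (seq y n ℚ.- seq y′ n) ∣
        ≤⟨ ℚ.∣p+q∣≤∣p∣+∣q∣ (seq x n ℚ.- seq x′ n) (seq y n ℚ.- seq y′ n) ⟩
      ℚ.∣ seq x n ℚ.- seq x′ n ∣ ℚ.+ ℚ.∣ seq y n ℚ.- seq y′ n ∣
        ≤⟨ ℚ.+-mono-≤ (hx n (ℕ.m⊔n≤o⇒m≤o M N M⊔N≤n)) (hy n (ℕ.m⊔n≤o⇒n≤o M N M⊔N≤n)) ⟩
      ε ℚ.* ½ ℚ.+ ε ℚ.* ½
        ≡⟨ halves ε ⟩
      ε ∎

  ≈ℝ-trans : ∀ {x y z} → x ≈ℝ y → y ≈ℝ z → x ≈ℝ z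
  ≈ℝ-trans {x} {y} {z} x≈y y≈z = eventually λ ε 0<ε →
    -- The splitting of ε was done in `+ℝ-cong`; here x - z = (x + y) - (y + z).
    let N , h = close (+ℝ-cong x≈y y≈z) ε 0<ε in N , λ n N≤n → begin
      ℚ.∣ seq x n ℚ.- seq z n ∣
        ≡⟨ ≡.cong ℚ.∣_∣ (solve 3 (λ a b c → a :- c := (a :+ b) :- (b :+ c))
             ≡.refl (seq x n) (seq y n) (seq z n)) ⟩
      ℚ.∣ (seq x n ℚ.+ seq y n) ℚ.- (seq y n ℚ.+ seq z n) ∣
        ≤⟨ h n N≤n ⟩
      ε ∎

  *ℝ-cong : ∀ {x x′ y y′} → x ≈ℝ x′ → y ≈ℝ y′ → x *ℝ y ≈ℝ x′ *ℝ y′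
  *ℝ-cong {x} {x′} {y} {y′} x≈x′ y≈y′ = eventually λ ε 0<ε →
    let A , 0<A , M₁ , bx = bounded (seq x′) (cauchy x′)
        B , 0<B , M₂ , by = bounded (seq y) (cauchy y)
        δ , 0<δ , δB≡ = quotient (half-pos 0<ε) 0<B
        η , 0<η , ηA≡ = quotient (half-pos 0<ε) 0<A
        M₃ , hx = close x≈x′ δ 0<δ
        M₄ , hy = close y≈y′ η 0<η
        M₁₂ = M₁ ℕ.⊔ M₂
        M₃₄ = M₃ ℕ.⊔ M₄
    in M₁₂ ℕ.⊔ M₃₄ , λ n M≤n →
      let M₁₂≤n = ℕ.m⊔n≤o⇒m≤o M₁₂ M₃₄ M≤n
          M₃₄≤n = ℕ.m⊔n≤o⇒n≤o M₁₂ M₃₄ M≤n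
      in ℚ.≤-trans
        (*-estimate (seq x n) (seq y n) (seq x′ n) (seq y′ n)
          (hx n (ℕ.m⊔n≤o⇒m≤o M₃ M₄ M₃₄≤n)) (hy n (ℕ.m⊔n≤o⇒n≤o M₃ M₄ M₃₄≤n))
          (by n (ℕ.m⊔n≤o⇒n≤o M₁ M₂ M₁₂≤n)) (bx n (ℕ.m⊔n≤o⇒m≤o M₁ M₂ M₁₂≤n)))
        (ℚ.≤-reflexive (≡.trans (≡.cong₂ ℚ._+_ δB≡ ηA≡) (halves ε)))

  -- With s the root and w the width, s² ≤ q ≤ (s + w)², so the error is at most w(2s + w). Here w ≤
  -- κL because w = 2⁻ⁿ(q + 1), and s, w ≤ L, the former from q ≤ K ≤ L².
  root-error : ∀ {q K κ} n → 0ℚ ℚ.≤ q → q ℚ.≤ K → 2⁻ n ℚ.≤ κ → let L = K ℚ.+ 1ℚ in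
    ℚ.∣ root q n ℚ.* root q n ℚ.- q ∣ ℚ.≤ κ ℚ.* (L ℚ.* (L ℚ.+ L ℚ.+ L))
  root-error {q} {K} {κ} n 0≤q q≤K 2⁻ⁿ≤κ = ∣-∣≤
    (ℚ.≤-trans (root²≤ q n 0≤q) (p≤p+q q 0≤bound))
    (begin
      q                           ≤⟨ ≤[root+width]² q n 0≤q ⟩
      (s ℚ.+ w) ℚ.* (s ℚ.+ w)     ≡⟨ solve 2 (λ s w → (s :+ w) :* (s :+ w) :=
                                       s :* s :+ w :* (s :+ s :+ w)) ≡.refl s w ⟩
      s ℚ.* s ℚ.+ w ℚ.* (s ℚ.+ s ℚ.+ w)
                                  ≤⟨ ℚ.+-monoʳ-≤ (s ℚ.* s) (*-mono-≤
                                       (+-nonNeg (+-nonNeg 0≤s 0≤s) (0≤width n 0≤q)) (*-nonNeg 0≤κ 0≤L)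
                                       w≤κL (ℚ.+-mono-≤ (ℚ.+-mono-≤ s≤L s≤L) w≤L)) ⟩
      s ℚ.* s ℚ.+ κ ℚ.* L ℚ.* (L ℚ.+ L ℚ.+ L)
                                  ≡⟨ ≡.cong (s ℚ.* s ℚ.+_) (ℚ.*-assoc κ L (L ℚ.+ L ℚ.+ L)) ⟩
      s ℚ.* s ℚ.+ bound           ∎)
    where
      s w L bound : ℚ
      s = root q n
      w = width q n
      L = K ℚ.+ 1ℚ
      bound = κ ℚ.* (L ℚ.* (L ℚ.+ L ℚ.+ L))
      0≤s : 0ℚ ℚ.≤ s
      0≤s = 0≤root q n 0≤q
      0≤1 : 0ℚ ℚ.≤ 1ℚ
      0≤1 = ℚ.nonNegative⁻¹ 1ℚ
      0≤κ : 0ℚ ℚ.≤ κ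
      0≤κ = ℚ.≤-trans (0≤2⁻ n) 2⁻ⁿ≤κ
      0≤K : 0ℚ ℚ.≤ K
      0≤K = ℚ.≤-trans 0≤q q≤K
      0≤L : 0ℚ ℚ.≤ L
      0≤L = +-nonNeg 0≤K 0≤1
      0≤bound : 0ℚ ℚ.≤ bound
      0≤bound = *-nonNeg 0≤κ (*-nonNeg 0≤L (+-nonNeg (+-nonNeg 0≤L 0≤L) 0≤L))
      q+1≤L : q ℚ.+ 1ℚ ℚ.≤ L
      q+1≤L = ℚ.+-monoˡ-≤ 1ℚ q≤K
      0≤q+1 : 0ℚ ℚ.≤ q ℚ.+ 1ℚ
      0≤q+1 = +-nonNeg 0≤q 0≤1
      w≤κL : w ℚ.≤ κ ℚ.* L
      w≤κL = ≡.subst (ℚ._≤ κ ℚ.* L) (≡.sym (width≡ q n)) (*-mono-≤ 0≤q+1 0≤κ 2⁻ⁿ≤κ q+1≤L)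
      w≤L : w ℚ.≤ L
      w≤L = ≡.subst₂ ℚ._≤_ (≡.sym (width≡ q n)) (ℚ.*-identityˡ L)
        (*-mono-≤ 0≤q+1 0≤1 (2⁻≤1 n) q+1≤L)
      s≤L : s ℚ.≤ L
      s≤L = square-cancel-≤ 0≤L (begin
        s ℚ.* s                         ≤⟨ root²≤ q n 0≤q ⟩
        q                               ≤⟨ q≤K ⟩
        K                               ≤⟨ p≤p+q K (+-nonNeg (*-nonNeg 0≤K 0≤K) 0≤L) ⟩
        K ℚ.+ (K ℚ.* K ℚ.+ L)           ≡⟨ solve 1 (λ K → K :+ (K :* K :+ (K :+ con 1ℚ)) :=
                                             (K :+ con 1ℚ) :* (K :+ con 1ℚ)) ≡.refl K ⟩
        L ℚ.* L                         ∎)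

  √-square : ∀ x → (∀ n → 0ℚ ℚ.≤ seq x n) → √ x *ℝ √ x ≈ℝ x
  √-square x 0≤x = eventually λ ε 0<ε →
    let K , 0<K , M , bx = bounded (seq x) (cauchy x)
        L = K ℚ.+ 1ℚ
        0<L = ℚ.+-mono-< 0<K (ℚ.positive⁻¹ 1ℚ)
        κ , 0<κ , κL[3L]≡ε = quotient 0<ε (*-pos 0<L (ℚ.+-mono-< (ℚ.+-mono-< 0<L 0<L) 0<L))
        N , h2 = 2⁻-null 0<κ
    in M ℕ.⊔ N , λ n M⊔N≤n →
      ≡.subst (λ q → ℚ.∣ root q n ℚ.* root q n ℚ.- seq x n ∣ ℚ.≤ ε)
        -- `√` takes roots of max(0, xₙ); termwise nonnegativity removes the maximum.
        (≡.sym (ℚ.p≤q⇒p⊔q≡q (0≤x n)))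
        (≡.subst (ℚ.∣ root (seq x n) n ℚ.* root (seq x n) n ℚ.- seq x n ∣ ℚ.≤_) κL[3L]≡ε
          (root-error n (0≤x n)
            (ℚ.≤-trans (p≤∣p∣ (seq x n)) (bx n (ℕ.m⊔n≤o⇒m≤o M N M⊔N≤n)))
            (h2 n (ℕ.m⊔n≤o⇒n≤o M N M⊔N≤n))))

  0≤p² : ∀ p → 0ℚ ℚ.≤ p ℚ.* p
  0≤p² p = ≡.subst (0ℚ ℚ.≤_) ∣p∣²≡p² (*-nonNeg (ℚ.0≤∣p∣ p) (ℚ.0≤∣p∣ p))
    where
      ∣p∣²≡p² : ℚ.∣ p ∣ ℚ.* ℚ.∣ p ∣ ≡ p ℚ.* p
      ∣p∣²≡p² with ℚ.∣p∣≡p∨∣p∣≡-p p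
      ... | inj₁ eq = ≡.cong₂ ℚ._*_ eq eq
      ... | inj₂ eq = ≡.trans (≡.cong₂ ℚ._*_ eq eq)
                        (solve 1 (λ p → :- p :* :- p := p :* p) ≡.refl p)

  ∣z∣² : ∀ z → ∣ z ∣ *ℝ ∣ z ∣ ≈ℝ re z *ℝ re z +ℝ im z *ℝ im z
  ∣z∣² z = √-square (re z *ℝ re z +ℝ im z *ℝ im z) λ n →
    +-nonNeg (0≤p² (seq (re z) n)) (0≤p² (seq (im z) n))

  -- The sequence 1/max(ε, xₙ) is total, and eventually equal to 1/xₙ.
  positive-inverse : ∀ x → 0ℝ <ℝ x → ∃ λ y → y *ℝ x ≈ℝ 1ℝ
  positive-inverse x (ε , 0<ε , N , 0+ε≤x) =
    real y y-cauchy , eventually λ η 0<η → N , λ n N≤n → p≡q⇒∣p-q∣≤ (y*x≡1 n N≤n) 0<η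
    where
      0<1 : 0ℚ ℚ.< 1ℚ
      0<1 = ℚ.positive⁻¹ 1ℚ
      ε⊔x : ℕ → ℚ
      ε⊔x n = ε ℚ.⊔ seq x n
      ε≤ε⊔x : ∀ n → ε ℚ.≤ ε⊔x n
      ε≤ε⊔x n = ℚ.p≤p⊔q ε (seq x n)
      reciprocal : ∀ n → ∃ λ δ → 0ℚ ℚ.< δ × δ ℚ.* ε⊔x n ≡ 1ℚ
      reciprocal n = quotient 0<1 (ℚ.<-≤-trans 0<ε (ε≤ε⊔x n))
      y : ℕ → ℚ
      y n = proj₁ (reciprocal n)
      0<y : ∀ n → 0ℚ ℚ.< y n
      0<y n = proj₁ (proj₂ (reciprocal n))
      y*x≡1 : ∀ n → N ℕ.≤ n → y n ℚ.* seq x n ≡ 1ℚ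
      y*x≡1 n N≤n = ≡.trans (≡.cong (y n ℚ.*_) (≡.sym (ℚ.p≤q⇒p⊔q≡q
          (≡.subst (ℚ._≤ seq x n) (ℚ.+-identityˡ ε) (0+ε≤x n N≤n)))))
        (proj₂ (proj₂ (reciprocal n)))
      K : ℚ
      K = proj₁ (quotient 0<1 0<ε)
      0<K : 0ℚ ℚ.< K
      0<K = proj₁ (proj₂ (quotient 0<1 0<ε))
      y≤K : ∀ n → y n ℚ.≤ K
      y≤K n = begin
        y n                         ≡⟨ ℚ.*-identityʳ (y n) ⟨
        y n ℚ.* 1ℚ                  ≡⟨ ≡.cong (y n ℚ.*_) (proj₂ (proj₂ (quotient 0<1 0<ε))) ⟨
        y n ℚ.* (K ℚ.* ε)           ≡⟨ solve 3 (λ y K e → y :* (K :* e) := K :* (y :* e)) ≡.refl (y n) K ε ⟩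
        K ℚ.* (y n ℚ.* ε)           ≤⟨ *-mono-≤ (*-nonNeg (ℚ.<⇒≤ (0<y n)) (ℚ.<⇒≤ 0<ε)) (ℚ.<⇒≤ 0<K) ℚ.≤-refl
                                         (*-mono-≤ (ℚ.<⇒≤ 0<ε) (ℚ.<⇒≤ (0<y n)) ℚ.≤-refl (ε≤ε⊔x n)) ⟩
        K ℚ.* (y n ℚ.* ε⊔x n)       ≡⟨ ≡.cong (K ℚ.*_) (proj₂ (proj₂ (reciprocal n))) ⟩
        K ℚ.* 1ℚ                    ≡⟨ ℚ.*-identityʳ K ⟩
        K                           ∎
      -- From N on, y_m - y_n = (x_n - x_m) y_m y_n, and the reciprocals are bounded by K = 1/ε;
      -- hence the choice δ = η/K².
      y-cauchy : Cauchy y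
      y-cauchy η 0<η =
        let δ , 0<δ , δK²≡η = quotient 0<η (*-pos 0<K 0<K)
            M , hx = cauchy x δ 0<δ
        in M ℕ.⊔ N , λ m n M⊔N≤m M⊔N≤n →
          let M≤m = ℕ.m⊔n≤o⇒m≤o M N M⊔N≤m
              N≤m = ℕ.m⊔n≤o⇒n≤o M N M⊔N≤m
              M≤n = ℕ.m⊔n≤o⇒m≤o M N M⊔N≤n
              N≤n = ℕ.m⊔n≤o⇒n≤o M N M⊔N≤n
          in begin
            ℚ.∣ y m ℚ.- y n ∣
              ≡⟨ ≡.cong ℚ.∣_∣ (difference m n N≤m N≤n) ⟩
            ℚ.∣ (seq x n ℚ.- seq x m) ℚ.* (y m ℚ.* y n) ∣
              ≡⟨ ℚ.∣p*q∣≡∣p∣*∣q∣ (seq x n ℚ.- seq x m) (y m ℚ.* y n) ⟩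
            ℚ.∣ seq x n ℚ.- seq x m ∣ ℚ.* ℚ.∣ y m ℚ.* y n ∣
              ≡⟨ ≡.cong (ℚ.∣ seq x n ℚ.- seq x m ∣ ℚ.*_) (ℚ.0≤p⇒∣p∣≡p (0≤yy m n)) ⟩
            ℚ.∣ seq x n ℚ.- seq x m ∣ ℚ.* (y m ℚ.* y n)
              ≤⟨ *-mono-≤ (0≤yy m n) (ℚ.<⇒≤ 0<δ) (hx n m M≤n M≤m)
                   (*-mono-≤ (ℚ.<⇒≤ (0<y n)) (ℚ.<⇒≤ 0<K) (y≤K m) (y≤K n)) ⟩
            δ ℚ.* (K ℚ.* K)
              ≡⟨ δK²≡η ⟩
            η ∎
        where
          0≤yy : ∀ m n → 0ℚ ℚ.≤ y m ℚ.* y n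
          0≤yy m n = *-nonNeg (ℚ.<⇒≤ (0<y m)) (ℚ.<⇒≤ (0<y n))
          difference : ∀ m n → N ℕ.≤ m → N ℕ.≤ n →
            y m ℚ.- y n ≡ (seq x n ℚ.- seq x m) ℚ.* (y m ℚ.* y n)
          difference m n N≤m N≤n = begin-equality
            y m ℚ.- y n
              ≡⟨ ≡.cong₂ ℚ._-_ (ℚ.*-identityʳ (y m)) (ℚ.*-identityʳ (y n)) ⟨
            y m ℚ.* 1ℚ ℚ.- y n ℚ.* 1ℚ
              ≡⟨ ≡.cong₂ (λ s t → y m ℚ.* s ℚ.- y n ℚ.* t) (y*x≡1 n N≤n) (y*x≡1 m N≤m) ⟨
            y m ℚ.* (y n ℚ.* seq x n) ℚ.- y n ℚ.* (y m ℚ.* seq x m)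
              ≡⟨ solve 4 (λ y y′ x x′ → y :* (y′ :* x′) :- y′ :* (y :* x) := (x′ :- x) :* (y :* y′))
                   ≡.refl (y m) (y n) (seq x m) (seq x n) ⟩
            (seq x n ℚ.- seq x m) ℚ.* (y m ℚ.* y n) ∎

  -- For 0 ≤ s ≤ 1 one has 1 - s² ≥ 1 - s, so the gap ε of ∣z∣ below 1 serves again.
  0<1-∣z∣² : ∀ z → ∣ z ∣ <ℝ 1ℝ → 0ℝ <ℝ 1ℝ +ℝ -ℝ (∣ z ∣ *ℝ ∣ z ∣)
  0<1-∣z∣² z (ε , 0<ε , N , ∣z∣+ε≤1) = ε , 0<ε , N , λ n N≤n →
    let s = seq ∣ z ∣ n
        q = seq (re z *ℝ re z +ℝ im z *ℝ im z) n
        0≤s = 0≤root (0ℚ ℚ.⊔ q) n (ℚ.p≤p⊔q 0ℚ q)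
        s≤1 = ℚ.≤-trans (p≤p+q s (ℚ.<⇒≤ 0<ε)) (∣z∣+ε≤1 n N≤n)
    in begin
      0ℚ ℚ.+ ε                ≡⟨ solve 2 (λ s e → con 0ℚ :+ e := (s :+ e) :- s) ≡.refl s ε ⟩
      (s ℚ.+ ε) ℚ.- s         ≤⟨ ℚ.+-monoˡ-≤ (ℚ.- s) (∣z∣+ε≤1 n N≤n) ⟩
      1ℚ ℚ.- s                ≡⟨ ≡.cong (λ t → 1ℚ ℚ.- t) (ℚ.*-identityʳ s) ⟨
      1ℚ ℚ.- s ℚ.* 1ℚ         ≤⟨ ℚ.+-monoʳ-≤ 1ℚ (ℚ.neg-antimono-≤
                                   (*-mono-≤ 0≤s 0≤s ℚ.≤-refl s≤1)) ⟩
      1ℚ ℚ.- s ℚ.* s          ∎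

-- The ring ℂ, its conjugation and its units.

module ComplexNumbers where
  open RealNumbers
  open +-*-Solver

  ≈-isEquivalence : IsEquivalence _≈_
  ≈-isEquivalence = record
    { refl  = componentwise ≈ℝ-refl ≈ℝ-refl
    ; sym   = λ z≈w → componentwise (≈ℝ-sym (re-≈ z≈w)) (≈ℝ-sym (im-≈ z≈w))
    ; trans = λ z≈w w≈u → componentwise
        (≈ℝ-trans (re-≈ z≈w) (re-≈ w≈u)) (≈ℝ-trans (im-≈ z≈w) (im-≈ w≈u))
    }

  +-cong : ∀ {z z′ w w′} → z ≈ z′ → w ≈ w′ → z + w ≈ z′ + w′
  +-cong z≈z′ w≈w′ = componentwise
    (+ℝ-cong (re-≈ z≈z′) (re-≈ w≈w′)) (+ℝ-cong (im-≈ z≈z′) (im-≈ w≈w′))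

  *-cong : ∀ {z z′ w w′} → z ≈ z′ → w ≈ w′ → z * w ≈ z′ * w′
  *-cong z≈z′ w≈w′ = componentwise
    (+ℝ-cong (*ℝ-cong (re-≈ z≈z′) (re-≈ w≈w′)) (-ℝ-cong (*ℝ-cong (im-≈ z≈z′) (im-≈ w≈w′))))
    (+ℝ-cong (*ℝ-cong (re-≈ z≈z′) (im-≈ w≈w′)) (*ℝ-cong (im-≈ z≈z′) (re-≈ w≈w′)))

  +-assoc : ∀ z w u → (z + w) + u ≈ z + (w + u)
  +-assoc z w u = componentwise
    (pointwise λ n → ℚ.+-assoc (seq (re z) n) (seq (re w) n) (seq (re u) n))
    (pointwise λ n → ℚ.+-assoc (seq (im z) n) (seq (im w) n) (seq (im u) n))

  +-comm : ∀ z w → z + w ≈ w + z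
  +-comm z w = componentwise
    (pointwise λ n → ℚ.+-comm (seq (re z) n) (seq (re w) n))
    (pointwise λ n → ℚ.+-comm (seq (im z) n) (seq (im w) n))

  +-identityˡ : ∀ z → 0ℂ + z ≈ z
  +-identityˡ z = componentwise
    (pointwise λ n → ℚ.+-identityˡ (seq (re z) n)) (pointwise λ n → ℚ.+-identityˡ (seq (im z) n))

  +-inverseʳ : ∀ z → z + - z ≈ 0ℂ
  +-inverseʳ z = componentwise
    (pointwise λ n → ℚ.+-inverseʳ (seq (re z) n)) (pointwise λ n → ℚ.+-inverseʳ (seq (im z) n))

  -‿cong : ∀ {z w} → z ≈ w → - z ≈ - w
  -‿cong z≈w = componentwise (-ℝ-cong (re-≈ z≈w)) (-ℝ-cong (im-≈ z≈w))

  *-assoc : ∀ z w u → (z * w) * u ≈ z * (w * u)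
  *-assoc z w u = componentwise
    (pointwise λ n → solve 6 (λ a b c d e f →
        (a :* c :+ :- (b :* d)) :* e :+ :- ((a :* d :+ b :* c) :* f) :=
        a :* (c :* e :+ :- (d :* f)) :+ :- (b :* (c :* f :+ d :* e))) ≡.refl
      (seq (re z) n) (seq (im z) n) (seq (re w) n) (seq (im w) n) (seq (re u) n) (seq (im u) n))
    (pointwise λ n → solve 6 (λ a b c d e f →
        (a :* c :+ :- (b :* d)) :* f :+ (a :* d :+ b :* c) :* e :=
        a :* (c :* f :+ d :* e) :+ b :* (c :* e :+ :- (d :* f))) ≡.refl
      (seq (re z) n) (seq (im z) n) (seq (re w) n) (seq (im w) n) (seq (re u) n) (seq (im u) n))

  *-comm : ∀ z w → z * w ≈ w * z
  *-comm z w = componentwise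
    (pointwise λ n → solve 4 (λ a b c d → a :* c :+ :- (b :* d) := c :* a :+ :- (d :* b)) ≡.refl
      (seq (re z) n) (seq (im z) n) (seq (re w) n) (seq (im w) n))
    (pointwise λ n → solve 4 (λ a b c d → a :* d :+ b :* c := c :* b :+ d :* a) ≡.refl
      (seq (re z) n) (seq (im z) n) (seq (re w) n) (seq (im w) n))

  *-identityˡ : ∀ z → 1ℂ * z ≈ z
  *-identityˡ z = componentwise
    (pointwise λ n → solve 2 (λ a b → con 1ℚ :* a :+ :- (con 0ℚ :* b) := a) ≡.refl
      (seq (re z) n) (seq (im z) n))
    (pointwise λ n → solve 2 (λ a b → con 1ℚ :* b :+ con 0ℚ :* a := b) ≡.refl
      (seq (re z) n) (seq (im z) n))

  *-distribʳ-+ : ∀ u z w → (z + w) * u ≈ z * u + w * u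
  *-distribʳ-+ u z w = componentwise
    (pointwise λ n → solve 6 (λ a b c d e f →
        (a :+ c) :* e :+ :- ((b :+ d) :* f) :=
        (a :* e :+ :- (b :* f)) :+ (c :* e :+ :- (d :* f))) ≡.refl
      (seq (re z) n) (seq (im z) n) (seq (re w) n) (seq (im w) n) (seq (re u) n) (seq (im u) n))
    (pointwise λ n → solve 6 (λ a b c d e f →
        (a :+ c) :* f :+ (b :+ d) :* e := (a :* f :+ b :* e) :+ (c :* f :+ d :* e)) ≡.refl
      (seq (re z) n) (seq (im z) n) (seq (re w) n) (seq (im w) n) (seq (re u) n) (seq (im u) n))

  ℂ-ring : CommutativeRing 0ℓ 0ℓ
  ℂ-ring = record
    { isCommutativeRing = record
      { isRing = record
        { +-isAbelianGroup = record
          { isGroup = record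
            { isMonoid = record
              { isSemigroup = record
                { isMagma = record { isEquivalence = ≈-isEquivalence ; ∙-cong = +-cong }
                ; assoc = +-assoc }
              ; identity = comm∧idˡ⇒id setoid +-comm +-identityˡ }
            ; inverse = comm∧invʳ⇒inv setoid +-comm +-inverseʳ
            ; ⁻¹-cong = -‿cong }
          ; comm = +-comm }
        ; *-cong = *-cong
        ; *-assoc = *-assoc
        ; *-identity = comm∧idˡ⇒id setoid *-comm *-identityˡ
        ; distrib = comm∧distrʳ⇒distr setoid +-cong *-comm *-distribʳ-+
        }
      ; *-comm = *-comm
      }
    }
    where
      setoid : Setoid 0ℓ 0ℓ
      setoid = record { isEquivalence = ≈-isEquivalence }

  conjugation : Involution (CommutativeRing.commutativeSemiring ℂ-ring)
  conjugation = record
    { _⋆ = conj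
    ; ⋆-cong = λ z≈w → componentwise (re-≈ z≈w) (-ℝ-cong (im-≈ z≈w))
    ; ⋆-+ = λ z w → componentwise ≈ℝ-refl
        (pointwise λ n → ℚ.neg-distrib-+ (seq (im z) n) (seq (im w) n))
    ; ⋆-* = λ z w → componentwise
        (pointwise λ n → solve 4 (λ a b c d →
            a :* c :+ :- (b :* d) := a :* c :+ :- (:- b :* :- d)) ≡.refl
          (seq (re z) n) (seq (im z) n) (seq (re w) n) (seq (im w) n))
        (pointwise λ n → solve 4 (λ a b c d →
            :- (a :* d :+ b :* c) := a :* :- d :+ :- b :* c) ≡.refl
          (seq (re z) n) (seq (im z) n) (seq (re w) n) (seq (im w) n))
    ; ⋆-involutive = λ z → componentwise ≈ℝ-refl
        (pointwise λ n → solve 1 (λ a → :- :- a := a) ≡.refl (seq (im z) n))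
    }

  fromℝ-* : ∀ x y → fromℝ (x *ℝ y) ≈ fromℝ x * fromℝ y
  fromℝ-* x y = componentwise
    (pointwise λ n → solve 2 (λ a b → a :* b := a :* b :+ :- (con 0ℚ :* con 0ℚ)) ≡.refl
      (seq x n) (seq y n))
    (pointwise λ n → solve 2 (λ a b → con 0ℚ := a :* con 0ℚ :+ con 0ℚ :* b) ≡.refl
      (seq x n) (seq y n))

  fromℝ-cong : ∀ {x y} → x ≈ℝ y → fromℝ x ≈ fromℝ y
  fromℝ-cong x≈y = componentwise x≈y ≈ℝ-refl

  fromℤ-neg : ∀ k → fromℤ (ℤ.- k) ≈ - fromℤ k
  fromℤ-neg (+ zero)   = componentwise (pointwise λ _ → ≡.refl) (pointwise λ _ → ≡.refl)
  fromℤ-neg (+ suc k)  = componentwise (pointwise λ _ → ≡.refl) (pointwise λ _ → ≡.refl)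
  -- A negative fraction is by definition the negation of a positive one, so only this case meets a
  -- double negation.
  fromℤ-neg ℤ.-[1+ k ] = componentwise
    (pointwise λ _ → solve 1 (λ a → a := :- :- a) ≡.refl (+ suc k ℚ./ 1)) (pointwise λ _ → ≡.refl)

  -- At z = α_s the left side is the factor 1 + β_s α_s of the norm recursion.
  1-∣z∣² : ∀ z → 1ℂ + - conj z * z ≈ fromℝ (1ℝ +ℝ -ℝ (∣ z ∣ *ℝ ∣ z ∣))
  1-∣z∣² z = componentwise
    (≈ℝ-trans
      (pointwise λ n → solve 2 (λ a b →
          con 1ℚ :+ (:- a :* a :+ :- (:- :- b :* b)) := con 1ℚ :+ :- (a :* a :+ b :* b)) ≡.refl
        (seq (re z) n) (seq (im z) n))
      (+ℝ-cong {1ℝ} ≈ℝ-refl (-ℝ-cong (≈ℝ-sym (∣z∣² z)))))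
    (pointwise λ n → solve 2 (λ a b →
        con 0ℚ :+ (:- a :* b :+ :- :- b :* a) := con 0ℚ) ≡.refl
      (seq (re z) n) (seq (im z) n))

  open CommutativeRing ℂ-ring using (setoid; trans; sym; *-congʳ; *-congˡ)

  unit-from-left-inverse : ∀ {z} w → w * z ≈ 1ℂ → Unit z
  unit-from-left-inverse {z} w wz≈1 = w , wz≈1 , trans (*-comm z w) wz≈1

  unit-cong : ∀ {z w} → z ≈ w → Unit z → Unit w
  unit-cong z≈w (u , uz≈1 , _) =
    unit-from-left-inverse u (trans (*-congˡ {u} (sym z≈w)) uz≈1)

  unit-* : ∀ {z w} → Unit z → Unit w → Unit (z * w)
  unit-* {z} {w} (u , uz≈1 , _) (v , vw≈1 , _) = unit-from-left-inverse (v * u) (begin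
    v * u * (z * w)     ≈⟨ *-assoc v u (z * w) ⟩
    v * (u * (z * w))   ≈⟨ *-congˡ {v} (*-assoc u z w) ⟨
    v * (u * z * w)     ≈⟨ *-congˡ {v} (*-congʳ {w} uz≈1) ⟩
    v * (1ℂ * w)        ≈⟨ *-congˡ {v} (*-identityˡ w) ⟩
    v * w               ≈⟨ vw≈1 ⟩
    1ℂ                  ∎)
    where open SetoidReasoning setoid

  positive-unit : ∀ x → 0ℝ <ℝ x → Unit (fromℝ x)
  positive-unit x 0<x = let y , yx≈1 = positive-inverse x 0<x in
    unit-from-left-inverse (fromℝ y) (trans (sym (fromℝ-* y x)) (fromℝ-cong yx≈1))

-- The case of complex Laurent polynomials.

open RealNumbers using (0<1-∣z∣²)
open ComplexNumbers
open CommutativeRing ℂ-ring using (commutativeSemiring; setoid; refl; sym; trans; *-congˡ; *-congʳ; *-identityʳ)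

module Laurents = LaurentAlgebra commutativeSemiring conjugation
open Laurents using (_≐_; pairing-≈; ⟦_⟧; laurentSemiring; laurentInvolution)
module Laurent≐ = CommutativeSemiring laurentSemiring

open Szegő ℂ-ring conjugation laurentSemiring laurentInvolution
open SumsOfMonomials ℂ-ring using (module IntegerCoefficients)
open IntegerCoefficients fromℤ refl fromℤ-neg using (sign; evalSum-sign; evalSum-rename)

if-*-+ : ∀ b a {c d} → c ≈ d → (if b then a + c else c) ≈ a * (if b then 1ℂ else 0ℂ) + d
if-*-+ true  a c≈d = +-cong (sym (*-identityʳ a)) c≈d
if-*-+ false a {c} {d} c≈d = sym (trans (+-cong (CommutativeRing.zeroʳ ℂ-ring a) (sym c≈d)) (+-identityˡ c))

-- A coefficient is the pairing with an indicator function. Equal pairings thus force equal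
-- coefficients, the equality that `𝓛` respects.
coeff≈⟦⟧ : ∀ f k → coeff f k ≈ ⟦ f ⟧ (λ i → if does (i ℤ.≟ k) then 1ℂ else 0ℂ)
coeff≈⟦⟧ []            k = refl
coeff≈⟦⟧ ((a , i) ∷ f) k = if-*-+ (does (i ℤ.≟ k)) a (coeff≈⟦⟧ f k)

≐⇒≋ : ∀ {f g} → f ≐ g → f ≋ g
≐⇒≋ {f} {g} f≐g = coeffwise λ k → trans (coeff≈⟦⟧ f k)
  (trans (pairing-≈ f≐g (λ i → if does (i ℤ.≟ k) then 1ℂ else 0ℂ)) (sym (coeff≈⟦⟧ g k)))

module _ (S : OPUC) where
  open OPUC S
  open IsLinear 𝓛-linear

  recursion : SzegőRecursion
  recursion = record
    { ι      = Laurents.ι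
    ; ι-★    = λ _ → Laurent≐.refl
    ; z      = λ n → z^ (+ n)
    ; z-zero = Laurent≐.refl
    ; z-suc  = λ n → Laurent≐.trans
        (Laurent≐.reflexive (≡.cong (λ k → z^ (+ k)) (ℕ.+-comm 1 n))) (Laurents.z^-+ (+ n) 1ℤ)
    ; z-unit = λ n → Laurents.z^⊛z^-★ (+ n)
    ; α      = α
    ; Φ      = Φ α
    ; Φ-zero = Laurent≐.refl
    ; Φ-suc  = λ n → Laurent≐.+-congˡ {z^ 1ℤ ⊛ Φ α n}
        (Laurents.·≐ι⊛ (- conj (α n)) (reversed n (Φ α n)))
    }

  functional : OrthogonalityFunctional recursion
  functional = record
    { F            = 𝓛
    ; F-cong       = λ f≐g → respects (≐⇒≋ f≐g)
    ; F-+          = additive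
    ; F-ι          = λ a f → trans
        (respects (≐⇒≋ (Laurent≐.sym (Laurents.·≐ι⊛ a f)))) (scales a f)
    ; F-normalised = 𝓛-normalised
    ; F-orthogonal = 𝓛-orthogonal
    }

  open OrthogonalityFunctional functional using (F-cong; F-ι; ∥Φ∥²-zero; M/∥Φ∥²≈Q)

  𝓛-★ : ∀ f → 𝓛 (conj[1/z] f) ≈ conj (𝓛 f)
  𝓛-★ = Laurents.LinearFunctional.F-★-from-monomials 𝓛 F-cong additive F-ι
    (F[z★]≈F[z]⋆ functional)

  open Hermitian functional 𝓛-★ using (∥Φ∥²-suc; reciprocity)

  ∥Φ∥²≈∏ : ∀ s → ∥Φ∥² s ≈ fromℝ (∏[1-∣α∣²] s)
  ∥Φ∥²≈∏ zero    = ∥Φ∥²-zero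
  ∥Φ∥²≈∏ (suc s) = trans (∥Φ∥²-suc s) (trans
    (*-cong (∥Φ∥²≈∏ s) (1-∣z∣² (α s)))
    (sym (fromℝ-* (∏[1-∣α∣²] s) (1ℝ +ℝ -ℝ (∣ α s ∣ *ℝ ∣ α s ∣)))))

  abstract
    -- A product of positive reals. It is kept abstract, like the inverse of the norm obtained from
    -- it, since only the inverse laws matter afterwards.
    ∏-unit : ∀ s → Unit (fromℝ (∏[1-∣α∣²] s))
    ∏-unit zero    = unit-from-left-inverse 1ℂ (*-identityˡ 1ℂ)
    ∏-unit (suc s) = unit-cong (sym (fromℝ-* (∏[1-∣α∣²] s) (1ℝ +ℝ -ℝ (∣ α s ∣ *ℝ ∣ α s ∣))))
      (unit-* (∏-unit s) (positive-unit _ (0<1-∣z∣² (α s) (∣α∣<1 s))))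

    Φ-unit : ∀ s → Unit (∥Φ∥² s)
    Φ-unit s = unit-cong (sym (∥Φ∥²≈∏ s)) (∏-unit s)

  μ≈Q : ∀ n r s → μ Φ-unit (+ n) r s ≈ SzegőRecursion.Q recursion n r s
  μ≈Q n r s = M/∥Φ∥²≈Q n r s (proj₁ (Φ-unit s)) (proj₂ (proj₂ (Φ-unit s)))

  μ-reciprocity : ∀ n r s → μ Φ-unit (-ℤ (+ n)) r s ≈
    conj (μ Φ-unit (+ n) s r) * (fromℝ (∏[1-∣α∣²] r) / fromℝ (∏[1-∣α∣²] s) [ ∏-unit s ])
  μ-reciprocity n r s = reciprocity n r s (z^ (-ℤ (+ n)))
    (proj₁ (Φ-unit r)) (proj₁ (Φ-unit s))
    (fromℝ (∏[1-∣α∣²] r)) (fromℝ (∏[1-∣α∣²] s)) (proj₁ (∏-unit s))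
    (Laurent≐.sym (Laurents.z^-★ (+ n)))
    (proj₁ (proj₂ (Φ-unit r))) (proj₁ (proj₂ (Φ-unit s)))
    (∥Φ∥²≈∏ r) (∥Φ∥²≈∏ s) (proj₂ (proj₂ (∏-unit s)))

  -- Both products are empty, yet the quotient is `1ℂ` times the opaque inverse from `∏-unit 0`;
  -- that factor is removed by the inverse law.
  μ-conj : ∀ n → μ Φ-unit (-ℤ (+ n)) 0 0 ≈ conj (μ Φ-unit (+ n) 0 0)
  μ-conj n = drop-unit-factor (conj (μ Φ-unit (+ n) 0 0)) (1ℂ * proj₁ (∏-unit 0))
    (μ-reciprocity n 0 0) (proj₂ (proj₂ (∏-unit 0)))

-- `recursion` is used as a family indexed by all of `OPUC`, which is why the monomials are fixed
-- before `S`.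
μ-integral : ∀ n r s → ∃[ P ] ((S : OPUC) → let open OPUC S in
  μ (Φ-unit S) (+ n) r s ≈ eval {Fin (n +ℕ r) ⊎ Fin (n +ℕ r)} [ α ∘ toℕ , ᾱ ∘ toℕ ] P)
μ-integral n r s = let ms , Q≈ = isSum-Q recursion (n +ℕ r) n r s ℕ.≤-refl in
  map (λ m → sign m , m) ms ,
  λ S → trans (μ≈Q S n r s) (trans (Q≈ S) (evalSum-sign (λ _ → refl) ms))

-- The same monomials, now each with coefficient 1, with bounded indices relabelled as natural
-- numbers.
μ-positive : ∀ n r s → ∃[ P ] (PositiveCoefficients P × ((S : OPUC) → let open OPUC S in
  μ (Φ-unit S) (+ n) r s ≈ eval {ℕ ⊎ ℕ} [ α , β ] P))
μ-positive n r s = let ms , Q≈ = isSum-Q recursion (n +ℕ r) n r s ℕ.≤-refl in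
  map (λ m → 1ℤ , map (Sum.map toℕ toℕ) m) ms ,
  All.map⁺ (All.universal (λ _ → ℤ.+<+ (ℕ.s≤s ℕ.z≤n)) ms) ,
  λ S → trans (μ≈Q S n r s) (trans (Q≈ S)
    (evalSum-rename (Sum.map toℕ toℕ) [ (λ _ → refl) , (λ _ → refl) ] ms))

theorem3p2 : Σ[ Φ-unit ∈ ((S : OPUC) (s : ℕ) → Unit (OPUC.∥Φ∥² S s)) ]
    Σ[ ∏-unit ∈ ((S : OPUC) (s : ℕ) → Unit (fromℝ (OPUC.∏[1-∣α∣²] S s))) ]
    (∀ (n r s : ℕ) →
    ∃[ P ] ((S : OPUC) → let open OPUC S in
    μ (Φ-unit S) (+ n) r s
    ≈ eval {Fin (n +ℕ r) ⊎ Fin (n +ℕ r)} [ α ∘ toℕ , ᾱ ∘ toℕ ] P))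
    × (∀ (n r s : ℕ) →
    ∃[ P ] (PositiveCoefficients P × ((S : OPUC) → let open OPUC S in
    μ (Φ-unit S) (+ n) r s ≈ eval {ℕ ⊎ ℕ} [ α , β ] P)))
    × (∀ (S : OPUC) (n r s : ℕ) → let open OPUC S in
    μ (Φ-unit S) (-ℤ (+ n)) r s
    ≈ conj (μ (Φ-unit S) (+ n) s r)
    * (fromℝ (∏[1-∣α∣²] r) / fromℝ (∏[1-∣α∣²] s) [ ∏-unit S s ]))
    × (∀ (S : OPUC) (n : ℕ) → let open OPUC S in
    μ (Φ-unit S) (-ℤ (+ n)) 0 0 ≈ conj (μ (Φ-unit S) (+ n) 0 0))
theorem3p2 = Φ-unit , ∏-unit , μ-integral , μ-positive , μ-reciprocity , μ-conj
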